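{- For all integers $i,j\ge 1$, \[|\beta_{i,j}|\le \frac12\sqrt{\frac1i+\frac1j}.\]
   Context: For a graph on $n$ vertices, $\lambda_1\ge\cdots\ge\lambda_n$ are the eigenvalues of its adjacency matrix. Let $\mathcal G_n$ be the family of simple graphs on $n$ vertices, with $\overline{G}$ the usual complement. For fixed positive integers $i,j$, \[\beta_{i,j}=\lim_{n\to\infty}\frac1n\min_{G\in\mathcal G_n}\bigl(\lambda_{n-i+1}(G)+\lambda_{n-j+1}(\overline{G})\bigr),\] a limit which is known to exist (Nikiforov). -}

module Defs where

open import Algebra.Bundles.Raw using (RawMonoid)
import Algebra.Definitions.RawMonoid as RawMonoidDefs
open import Data.Bool.Base using (Bool; true; false; not; _∧_; if_then_else_)
open import Data.Bool.Properties using (∧-zeroʳ)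
open import Data.Fin.Base as Fin using (Fin; fromℕ<)
import Data.Fin.Properties as Fin
open import Data.Integer.Base as ℤ using (+_; +[1+_]; -[1+_]; +<+; +≤+; -<+)
import Data.Integer.Properties as ℤ
open import Data.Nat.Base as ℕ using (ℕ; zero; suc; NonZero; s≤s; z≤n)
import Data.Nat.Properties as ℕ
open import Data.Product.Base using (∃-syntax; Σ-syntax; _×_; _,_)
open import Data.Rational.Base as ℚ using (ℚ; 0ℚ; 1ℚ; ½; _/_; ↥_; mkℚ; toℚᵘ; *<*; *≤*)
import Data.Rational.Properties as ℚ
open import Data.Rational.Solver using (module +-*-Solver)
import Data.Rational.Unnormalised.Base as ℚᵘ
import Data.Rational.Unnormalised.Properties as ℚᵘ
open import Data.Sum.Base using (inj₁; inj₂)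
open import Data.Vec.Functional using (Vector)
open import Relation.Binary.PropositionalEquality
  using (_≡_; refl; sym; trans; cong; subst; subst₂)
open import Relation.Nullary.Decidable using (Dec; yes; no; does; dec-true)
open import Relation.Nullary.Negation using (¬_; contradiction)

open +-*-Solver using (solve; _:=_; _:+_; _:*_; _:-_; :-_)

0<* : ∀ {p q} → 0ℚ ℚ.< p → 0ℚ ℚ.< q → 0ℚ ℚ.< p ℚ.* q
0<* {p} {q} 0<p 0<q =
  ℚ.positive⁻¹ (p ℚ.* q)
    {{ℚ.pos*pos⇒pos p {{ℚ.positive 0<p}} q {{ℚ.positive 0<q}}}}

0<½* : ∀ {ε} → 0ℚ ℚ.< ε → 0ℚ ℚ.< ½ ℚ.* ε
0<½* = 0<* (ℚ.positive⁻¹ ½)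

½+½ : ∀ ε → ½ ℚ.* ε ℚ.+ ½ ℚ.* ε ≡ ε
½+½ ε = trans (sym (ℚ.*-distribʳ-+ ε ½ ½)) (ℚ.*-identityˡ ε)

p≤∣p∣ : ∀ p → p ℚ.≤ ℚ.∣ p ∣
p≤∣p∣ p with ℚ.∣p∣≡p∨∣p∣≡-p p
... | inj₁ eq = ℚ.≤-reflexive (sym eq)
... | inj₂ eq = ℚ.≤-trans p≤0 (ℚ.0≤∣p∣ p)
  where
  p≤0 : p ℚ.≤ 0ℚ
  p≤0 = subst₂ ℚ._≤_ (solve 1 (λ x → :- (:- x) := x) refl p) refl
          (ℚ.neg-antimono-≤ (subst (0ℚ ℚ.≤_) eq (ℚ.0≤∣p∣ p)))

∣∣-< : ∀ {p q} → p ℚ.< q → ℚ.- p ℚ.< q → ℚ.∣ p ∣ ℚ.< q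
∣∣-< {p} p<q -p<q with ℚ.∣p∣≡p∨∣p∣≡-p p
... | inj₁ eq = subst (ℚ._< _) (sym eq) p<q
... | inj₂ eq = subst (ℚ._< _) (sym eq) -p<q

+⇒- : ∀ {x ε} y → x ℚ.< y ℚ.+ ε → x ℚ.- y ℚ.< ε
+⇒- {x} {ε} y x<y+ε =
  subst (x ℚ.- y ℚ.<_) (solve 2 (λ a b → (a :+ b) :- a := b) refl y ε)
    (ℚ.+-monoˡ-< (ℚ.- y) x<y+ε)

-⇒+ : ∀ {x ε} y → x ℚ.- y ℚ.< ε → x ℚ.< y ℚ.+ ε
-⇒+ {x} {ε} y x-y<ε =
  subst (ℚ._< y ℚ.+ ε) (solve 2 (λ a b → b :+ (a :- b) := a) refl x y)
    (ℚ.+-monoʳ-< y x-y<ε)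

swap- : ∀ x y → ℚ.- (x ℚ.- y) ≡ y ℚ.- x
swap- = solve 2 (λ a b → :- (a :- b) := b :- a) refl

∣-∣-< : ∀ {x y ε} → x ℚ.< y ℚ.+ ε → y ℚ.< x ℚ.+ ε → ℚ.∣ x ℚ.- y ∣ ℚ.< ε
∣-∣-< {x} {y} x<y+ε y<x+ε =
  ∣∣-< (+⇒- y x<y+ε) (subst (ℚ._< _) (sym (swap- x y)) (+⇒- x y<x+ε))

∣-∣-<⇒< : ∀ {x y ε} → ℚ.∣ x ℚ.- y ∣ ℚ.< ε → x ℚ.< y ℚ.+ ε
∣-∣-<⇒< {x} {y} d<ε = -⇒+ y (ℚ.≤-<-trans (p≤∣p∣ (x ℚ.- y)) d<ε)

∣∣-triangle : ∀ x y → ℚ.∣ x ∣ ℚ.- ℚ.∣ y ∣ ℚ.≤ ℚ.∣ x ℚ.- y ∣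
∣∣-triangle x y =
  subst (ℚ.∣ x ∣ ℚ.- ℚ.∣ y ∣ ℚ.≤_)
    (solve 2 (λ d b → (d :+ b) :- b := d) refl ℚ.∣ x ℚ.- y ∣ ℚ.∣ y ∣)
    (ℚ.+-monoˡ-≤ (ℚ.- ℚ.∣ y ∣)
      (subst (ℚ._≤ ℚ.∣ x ℚ.- y ∣ ℚ.+ ℚ.∣ y ∣)
        (cong ℚ.∣_∣ (solve 2 (λ a b → (a :- b) :+ b := a) refl x y))
        (ℚ.∣p+q∣≤∣p∣+∣q∣ (x ℚ.- y) y)))

*-mono-≤ : ∀ {p q r s} → 0ℚ ℚ.≤ q → 0ℚ ℚ.≤ r →
           p ℚ.≤ q → r ℚ.≤ s → p ℚ.* r ℚ.≤ q ℚ.* s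
*-mono-≤ {p} {q} {r} {s} 0≤q 0≤r p≤q r≤s =
  ℚ.≤-trans (ℚ.*-monoʳ-≤-nonNeg r {{ℚ.nonNegative 0≤r}} p≤q)
            (ℚ.*-monoˡ-≤-nonNeg q {{ℚ.nonNegative 0≤q}} r≤s)

square-cancel-< : ∀ {p q} → 0ℚ ℚ.≤ q → p ℚ.* p ℚ.< q ℚ.* q → p ℚ.< q
square-cancel-< {p} {q} 0≤q pp<qq with p ℚ.<? q
... | yes p<q = p<q
... | no  p≮q = contradiction
  (ℚ.<-≤-trans pp<qq (*-mono-≤ (ℚ.≤-trans 0≤q q≤p) 0≤q q≤p q≤p))
  (ℚ.<-irrefl refl)
  where
  q≤p = ℚ.≮⇒≥ p≮q

-- The reals are Cauchy sequences of rationals with pointwise operations.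
-- Their equality is _≈_, not propositional equality.
IsCauchy : (ℕ → ℚ) → Set
IsCauchy x =
  ∀ ε → 0ℚ ℚ.< ε → ∃[ N ] ∀ m n → N ℕ.≤ m → N ℕ.≤ n → ℚ.∣ x m ℚ.- x n ∣ ℚ.< ε

record ℝ : Set where
  constructor mkℝ
  field
    seq    : ℕ → ℚ
    cauchy : IsCauchy seq

open ℝ public

infix 4 _≈_ _≤_ _<_

_≤_ : ℝ → ℝ → Set
x ≤ y = ∀ ε → 0ℚ ℚ.< ε → ∃[ N ] ∀ n → N ℕ.≤ n → seq x n ℚ.≤ seq y n ℚ.+ ε

_≈_ : ℝ → ℝ → Set
x ≈ y =
  ∀ ε → 0ℚ ℚ.< ε → ∃[ N ] ∀ n → N ℕ.≤ n → ℚ.∣ seq x n ℚ.- seq y n ∣ ℚ.< ε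

_<_ : ℝ → ℝ → Set
x < y = ∃[ ε ] 0ℚ ℚ.< ε × ∃[ N ] ∀ n → N ℕ.≤ n → seq x n ℚ.+ ε ℚ.≤ seq y n

fromℚ : ℚ → ℝ
fromℚ q = mkℝ (λ _ → q) λ ε 0<ε →
  0 , λ _ _ _ _ → subst (ℚ._< ε) (sym (cong ℚ.∣_∣ (ℚ.+-inverseʳ q))) 0<ε

0ℝ 1ℝ : ℝ
0ℝ = fromℚ 0ℚ
1ℝ = fromℚ 1ℚ

infixl 6 _+_ _-_
infixl 7 _*_
infix  8 -_

_+_ : ℝ → ℝ → ℝ
seq (x + y) n = seq x n ℚ.+ seq y n
cauchy (x + y) ε 0<ε
  with cauchy x (½ ℚ.* ε) (0<½* 0<ε) | cauchy y (½ ℚ.* ε) (0<½* 0<ε)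
... | M , f | N , g = M ℕ.⊔ N , λ m n p q →
  subst₂ ℚ._<_
    (cong ℚ.∣_∣ (sym (+-swap (seq x m) (seq x n) (seq y m) (seq y n)))) (½+½ ε)
    (ℚ.≤-<-trans (ℚ.∣p+q∣≤∣p∣+∣q∣ (seq x m ℚ.- seq x n) (seq y m ℚ.- seq y n))
      (ℚ.+-mono-<
        (f m n (ℕ.m⊔n≤o⇒m≤o M N p) (ℕ.m⊔n≤o⇒m≤o M N q))
        (g m n (ℕ.m⊔n≤o⇒n≤o M N p) (ℕ.m⊔n≤o⇒n≤o M N q))))
  where
  +-swap : ∀ a b c d →
           (a ℚ.+ c) ℚ.- (b ℚ.+ d) ≡ (a ℚ.- b) ℚ.+ (c ℚ.- d)
  +-swap = solve 4 (λ a b c d → (a :+ c) :- (b :+ d) := (a :- b) :+ (c :- d)) refl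

-_ : ℝ → ℝ
seq (- x) n = ℚ.- seq x n
cauchy (- x) ε 0<ε with cauchy x ε 0<ε
... | N , f = N , λ m n p q →
  subst (ℚ._< ε)
    (trans (sym (ℚ.∣-p∣≡∣p∣ (seq x m ℚ.- seq x n)))
           (cong ℚ.∣_∣ (ℚ.neg-distrib-+ (seq x m) (ℚ.- seq x n))))
    (f m n p q)

_-_ : ℝ → ℝ → ℝ
x - y = x + - y

∣_∣ : ℝ → ℝ
seq ∣ x ∣ n = ℚ.∣ seq x n ∣
cauchy ∣ x ∣ ε 0<ε with cauchy x ε 0<ε
... | N , f = N , λ m n p q →
  ∣∣-< (ℚ.≤-<-trans (∣∣-triangle (seq x m) (seq x n)) (f m n p q))
       (subst (ℚ._< ε) (sym (swap- ℚ.∣ seq x m ∣ ℚ.∣ seq x n ∣))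
         (ℚ.≤-<-trans (∣∣-triangle (seq x n) (seq x m)) (f n m q p)))

shrink : ∀ B ε → 0ℚ ℚ.< B → 0ℚ ℚ.< ε → ∃[ δ ] 0ℚ ℚ.< δ × δ ℚ.* B ≡ ε
shrink B ε 0<B 0<ε = ε ℚ.* 1/B , 0<* 0<ε 0<1/B ,
  trans (ℚ.*-assoc ε 1/B B)
    (trans (cong (ε ℚ.*_) (ℚ.*-inverseˡ B {{B≢0}})) (ℚ.*-identityʳ ε))
  where
  B⁺ = ℚ.positive 0<B
  B≢0 = ℚ.pos⇒nonZero B {{B⁺}}
  1/B = (ℚ.1/ B) {{B≢0}}
  0<1/B = ℚ.positive⁻¹ 1/B {{ℚ.1/pos⇒pos B {{B⁺}}}}

product-< : ∀ {p q ε B δ} → ℚ.∣ p ∣ ℚ.< δ → ℚ.∣ q ∣ ℚ.< B → 0ℚ ℚ.< B →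
            δ ℚ.* B ≡ ε → ℚ.∣ p ℚ.* q ∣ ℚ.< ε
product-< {p} {q} {ε} {B} {δ} p<δ q<B 0<B δB≡ε =
  subst₂ ℚ._<_ (sym (ℚ.∣p*q∣≡∣p∣*∣q∣ p q)) δB≡ε
    (ℚ.≤-<-trans
      (ℚ.*-monoˡ-≤-nonNeg ℚ.∣ p ∣ {{ℚ.nonNegative (ℚ.0≤∣p∣ p)}} (ℚ.<⇒≤ q<B))
      (ℚ.*-monoˡ-<-pos B {{ℚ.positive 0<B}} p<δ))

*-close : ∀ {x y z w B C δ η} ε → ℚ.∣ x ℚ.- y ∣ ℚ.< η → ℚ.∣ z ∣ ℚ.< C →
  ℚ.∣ z ℚ.- w ∣ ℚ.< δ → ℚ.∣ y ∣ ℚ.< B → 0ℚ ℚ.< B → 0ℚ ℚ.< C →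
  δ ℚ.* B ≡ ½ ℚ.* ε → η ℚ.* C ≡ ½ ℚ.* ε →
  ℚ.∣ x ℚ.* z ℚ.- y ℚ.* w ∣ ℚ.< ε
*-close {x} {y} {z} {w} ε x-y<η z<C z-w<δ y<B 0<B 0<C δB ηC =
  subst₂ ℚ._<_ (cong ℚ.∣_∣ (*-swap x y z w)) (½+½ ε)
    (ℚ.≤-<-trans (ℚ.∣p+q∣≤∣p∣+∣q∣ ((x ℚ.- y) ℚ.* z) ((z ℚ.- w) ℚ.* y))
      (ℚ.+-mono-< (product-< x-y<η z<C 0<C ηC) (product-< z-w<δ y<B 0<B δB)))
  where
  *-swap : ∀ a b c d →
           (a ℚ.- b) ℚ.* c ℚ.+ (c ℚ.- d) ℚ.* b ≡ a ℚ.* c ℚ.- b ℚ.* d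
  *-swap = solve 4 (λ a b c d →
    (a :- b) :* c :+ (c :- d) :* b := a :* c :- b :* d) refl

EventuallyBounded : (ℕ → ℚ) → Set
EventuallyBounded x =
  ∃[ B ] 0ℚ ℚ.< B × ∃[ N ] ∀ n → N ℕ.≤ n → ℚ.∣ x n ∣ ℚ.< B

bounded : ∀ x → EventuallyBounded (seq x)
bounded x with cauchy x 1ℚ (ℚ.positive⁻¹ 1ℚ)
... | N , f = B , 0<B , N , λ n N≤n →
  -⇒+ ℚ.∣ seq x N ∣
    (ℚ.≤-<-trans (∣∣-triangle (seq x n) (seq x N)) (f n N N≤n ℕ.≤-refl))
  where
  B = ℚ.∣ seq x N ∣ ℚ.+ 1ℚ
  0<B : 0ℚ ℚ.< B
  0<B = ℚ.+-mono-≤-< (ℚ.0≤∣p∣ (seq x N)) (ℚ.positive⁻¹ 1ℚ)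

*-cauchy : ∀ x y → IsCauchy x → IsCauchy y →
           EventuallyBounded x → EventuallyBounded y →
           IsCauchy (λ n → x n ℚ.* y n)
*-cauchy x y x-cauchy y-cauchy (B , 0<B , K , b) (C , 0<C , L , c) ε 0<ε =
  fromShrink (shrink B (½ ℚ.* ε) 0<B (0<½* 0<ε)) (shrink C (½ ℚ.* ε) 0<C (0<½* 0<ε))
  where
  Goal = ∃[ N ] ∀ m n → N ℕ.≤ m → N ℕ.≤ n → ℚ.∣ x m ℚ.* y m ℚ.- x n ℚ.* y n ∣ ℚ.< ε
  fromModuli : ∀ {δ η} → δ ℚ.* B ≡ ½ ℚ.* ε → η ℚ.* C ≡ ½ ℚ.* ε →
    (∃[ M ] ∀ m n → M ℕ.≤ m → M ℕ.≤ n → ℚ.∣ x m ℚ.- x n ∣ ℚ.< η) →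
    (∃[ N ] ∀ m n → N ℕ.≤ m → N ℕ.≤ n → ℚ.∣ y m ℚ.- y n ∣ ℚ.< δ) → Goal
  fromModuli δB ηC (M , f) (N , g) = (K ℕ.⊔ L) ℕ.⊔ (M ℕ.⊔ N) , λ m n p q →
    *-close {x m} {x n} {y m} {y n} ε (f m n (toM p) (toM q)) (c m (toL p))
              (g m n (toN p) (toN q)) (b n (toK q)) 0<B 0<C δB ηC
    where
    toK : ∀ {k} → (K ℕ.⊔ L) ℕ.⊔ (M ℕ.⊔ N) ℕ.≤ k → K ℕ.≤ k
    toK p = ℕ.m⊔n≤o⇒m≤o K L (ℕ.m⊔n≤o⇒m≤o (K ℕ.⊔ L) (M ℕ.⊔ N) p)
    toL : ∀ {k} → (K ℕ.⊔ L) ℕ.⊔ (M ℕ.⊔ N) ℕ.≤ k → L ℕ.≤ k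
    toL p = ℕ.m⊔n≤o⇒n≤o K L (ℕ.m⊔n≤o⇒m≤o (K ℕ.⊔ L) (M ℕ.⊔ N) p)
    toM : ∀ {k} → (K ℕ.⊔ L) ℕ.⊔ (M ℕ.⊔ N) ℕ.≤ k → M ℕ.≤ k
    toM p = ℕ.m⊔n≤o⇒m≤o M N (ℕ.m⊔n≤o⇒n≤o (K ℕ.⊔ L) (M ℕ.⊔ N) p)
    toN : ∀ {k} → (K ℕ.⊔ L) ℕ.⊔ (M ℕ.⊔ N) ℕ.≤ k → N ℕ.≤ k
    toN p = ℕ.m⊔n≤o⇒n≤o M N (ℕ.m⊔n≤o⇒n≤o (K ℕ.⊔ L) (M ℕ.⊔ N) p)
  fromShrink : (∃[ δ ] 0ℚ ℚ.< δ × δ ℚ.* B ≡ ½ ℚ.* ε) →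
               (∃[ η ] 0ℚ ℚ.< η × η ℚ.* C ≡ ½ ℚ.* ε) → Goal
  fromShrink (δ , 0<δ , δB) (η , 0<η , ηC) =
    fromModuli δB ηC (x-cauchy η 0<η) (y-cauchy δ 0<δ)

_*_ : ℝ → ℝ → ℝ
seq (x * y) n = seq x n ℚ.* seq y n
cauchy (x * y) =
  *-cauchy (seq x) (seq y) (cauchy x) (cauchy y) (bounded x) (bounded y)

infixl 7 _⊙_

_⊙_ : ℕ → ℚ → ℚ
s ⊙ h = (+ s / 1) ℚ.* h

-- The largest s ≤ B satisfying P, and 0 if there is none.
largest : ∀ {P : ℕ → Set} → (∀ s → Dec (P s)) → ℕ → ℕ
largest P? zero    = 0
largest P? (suc s) = if does (P? (suc s)) then suc s else largest P? s

largest-holds : ∀ {P : ℕ → Set} (P? : ∀ s → Dec (P s)) B → P 0 → P (largest P? B)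
largest-holds P? zero    P0 = P0
largest-holds P? (suc s) P0 with P? (suc s)
... | yes Ps = Ps
... | no  _  = largest-holds P? s P0

largest-maximal : ∀ {P : ℕ → Set} (P? : ∀ s → Dec (P s)) B →
                  ¬ P (suc B) → ¬ P (suc (largest P? B))
largest-maximal P? zero    ¬P = ¬P
largest-maximal P? (suc s) ¬P with P? (suc s)
... | yes _  = ¬P
... | no ¬Ps = largest-maximal P? s ¬Ps

gridRoot : (a h : ℚ) (B : ℕ) → ℕ
gridRoot a h = largest (λ s → (s ⊙ h) ℚ.* (s ⊙ h) ℚ.≤? a)

mesh : ℕ → ℚ
mesh k = + 1 / suc k

-- With M = |numerator of a| + 1 we have a < M ≤ M², so the search bound
-- (k + 1) M is large enough: for a ≥ 0 the value r satisfies
-- r² ≤ a < (r + 1/(k+1))².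
approx√ : ℚ → ℕ → ℚ
approx√ a k = gridRoot a (mesh k) (suc k ℕ.* suc ℤ.∣ ↥ a ∣) ⊙ mesh k

toᵘ : ∀ n d .{{_ : NonZero d}} → toℚᵘ (n / d) ℚᵘ.≃ (n ℚᵘ./ d)
toᵘ n (suc d) = ℚ.toℚᵘ-fromℚᵘ (ℚᵘ.mkℚᵘ n d)

mesh>0 : ∀ k → 0ℚ ℚ.< mesh k
mesh>0 k = ℚ.positive⁻¹ (mesh k) {{ℚ.normalize-pos 1 (suc k)}}

mesh-small : ∀ ε → 0ℚ ℚ.< ε → ∃[ N ] ∀ k → N ℕ.≤ k → mesh k ℚ.< ε
mesh-small (mkℚ (+ zero) d _)  (*<* (+<+ ()))
mesh-small (mkℚ -[1+ _ ] d _)  (*<* ())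
mesh-small (mkℚ +[1+ a ] d _) _ = suc d , λ k N≤k →
  ℚ.toℚᵘ-cancel-< (ℚᵘ.<-respˡ-≃ (ℚᵘ.≃-sym (toᵘ (+ 1) (suc k)))
    (ℚᵘ.*<* (+<+ (s≤s (subst (ℕ._≤ k ℕ.+ a ℕ.* suc k) (sym (cong suc (ℕ.+-identityʳ d)))
      (ℕ.≤-trans N≤k (ℕ.m≤m+n k (a ℕ.* suc k))))))))

suc⊙ : ∀ s h → suc s ⊙ h ≡ s ⊙ h ℚ.+ h
suc⊙ s h =
  trans (cong (ℚ._* h) suc/1)
    (trans (ℚ.*-distribʳ-+ h (+ s / 1) 1ℚ)
           (cong (s ⊙ h ℚ.+_) (ℚ.*-identityˡ h)))
  where
  suc/1 : + suc s / 1 ≡ (+ s / 1) ℚ.+ 1ℚ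
  suc/1 = ℚ.toℚᵘ-injective (ℚᵘ.≃-trans (toᵘ (+ suc s) 1) (ℚᵘ.≃-trans step
    (ℚᵘ.≃-sym (ℚᵘ.≃-trans (ℚ.toℚᵘ-homo-+ (+ s / 1) 1ℚ)
      (ℚᵘ.+-congˡ (toℚᵘ 1ℚ) (toᵘ (+ s) 1))))))
    where
    step : (+ suc s ℚᵘ./ 1) ℚᵘ.≃ (+ s ℚᵘ./ 1) ℚᵘ.+ toℚᵘ 1ℚ
    step = ℚᵘ.*≡* (cong (ℤ._* + 1)
      (trans (cong +_ (ℕ.+-comm 1 s)) (cong (ℤ._+ + 1) (sym (ℤ.*-identityʳ (+ s))))))

⊙-mesh : ∀ k M → (suc k ℕ.* M) ⊙ mesh k ≡ + M / 1
⊙-mesh k M = ℚ.toℚᵘ-injective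
  (ℚᵘ.≃-trans (ℚ.toℚᵘ-homo-* (+ (suc k ℕ.* M) / 1) (mesh k))
    (ℚᵘ.≃-trans (ℚᵘ.*-cong (toᵘ (+ (suc k ℕ.* M)) 1) (toᵘ (+ 1) (suc k)))
      (ℚᵘ.≃-trans (ℚᵘ.*≡* eq) (ℚᵘ.≃-sym (toᵘ (+ M) 1)))))
  where
  eq : (+ (suc k ℕ.* M) ℤ.* + 1) ℤ.* + 1 ≡ + M ℤ.* + suc (k ℕ.+ 0)
  eq = trans (ℤ.*-identityʳ _) (trans (ℤ.*-identityʳ _)
    (trans (cong +_ (ℕ.*-comm (suc k) M))
      (trans (ℤ.pos-* M (suc k))
        (cong (λ t → + M ℤ.* + suc t) (sym (ℕ.+-identityʳ k))))))

⊙≥0 : ∀ s {h} → 0ℚ ℚ.< h → 0ℚ ℚ.≤ s ⊙ h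
⊙≥0 zero    {h} _   = ℚ.≤-reflexive (sym (ℚ.*-zeroˡ h))
⊙≥0 (suc s) {h} 0<h =
  subst (0ℚ ℚ.≤_) (sym (suc⊙ s h)) (ℚ.+-mono-≤ (⊙≥0 s 0<h) (ℚ.<⇒≤ 0<h))

gridRoot-lower : ∀ a h B → 0ℚ ℚ.≤ a →
  (gridRoot a h B ⊙ h) ℚ.* (gridRoot a h B ⊙ h) ℚ.≤ a
gridRoot-lower a h B 0≤a =
  largest-holds (λ s → (s ⊙ h) ℚ.* (s ⊙ h) ℚ.≤? a) B
    (subst (ℚ._≤ a)
      (sym (trans (cong (ℚ._* (0 ⊙ h)) (ℚ.*-zeroˡ h)) (ℚ.*-zeroˡ (0 ⊙ h)))) 0≤a)

gridRoot-upper : ∀ a h B → a ℚ.< (suc B ⊙ h) ℚ.* (suc B ⊙ h) →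
  a ℚ.< (suc (gridRoot a h B) ⊙ h) ℚ.* (suc (gridRoot a h B) ⊙ h)
gridRoot-upper a h B lt =
  ℚ.≰⇒> (largest-maximal (λ s → (s ⊙ h) ℚ.* (s ⊙ h) ℚ.≤? a) B
    λ le → ℚ.<-irrefl refl (ℚ.<-≤-trans lt le))

a<M : ∀ a → a ℚ.< + suc ℤ.∣ ↥ a ∣ / 1
a<M a@(mkℚ n d _) = ℚ.toℚᵘ-cancel-< (ℚᵘ.<-respʳ-≃ (ℚᵘ.≃-sym (toᵘ (+ suc ℤ.∣ n ∣) 1))
  (ℚᵘ.*<* (subst (ℤ._< + suc ℤ.∣ n ∣ ℤ.* + suc d) (sym (ℤ.*-identityʳ n)) (lemma n))))
  where
  lemma : ∀ m → m ℤ.< + suc ℤ.∣ m ∣ ℤ.* + suc d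
  lemma (+ m)    = +<+ (ℕ.m≤m*n (suc m) (suc d))
  lemma -[1+ m ] = -<+

1≤M : ∀ m → 1ℚ ℚ.≤ + suc m / 1
1≤M m = ℚ.toℚᵘ-cancel-≤ (ℚᵘ.≤-respʳ-≃ (ℚᵘ.≃-sym (toᵘ (+ suc m) 1))
  (ℚᵘ.*≤* (+≤+ (s≤s z≤n))))

a<M² : ∀ a → a ℚ.< (+ suc ℤ.∣ ↥ a ∣ / 1) ℚ.* (+ suc ℤ.∣ ↥ a ∣ / 1)
a<M² a = ℚ.<-≤-trans (a<M a)
  (subst (ℚ._≤ M ℚ.* M) (ℚ.*-identityˡ M)
    (*-mono-≤ 0≤M 0≤M (1≤M ℤ.∣ ↥ a ∣) ℚ.≤-refl))
  where
  M = + suc ℤ.∣ ↥ a ∣ / 1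
  0≤M : 0ℚ ℚ.≤ M
  0≤M = ℚ.≤-trans (ℚ.nonNegative⁻¹ 1ℚ) (1≤M ℤ.∣ ↥ a ∣)

approx√-nonneg : ∀ a k → 0ℚ ℚ.≤ approx√ a k
approx√-nonneg a k =
  ⊙≥0 (gridRoot a (mesh k) (suc k ℕ.* suc ℤ.∣ ↥ a ∣)) (mesh>0 k)

approx√-lower : ∀ a k → 0ℚ ℚ.≤ a → approx√ a k ℚ.* approx√ a k ℚ.≤ a
approx√-lower a k = gridRoot-lower a (mesh k) (suc k ℕ.* suc ℤ.∣ ↥ a ∣)

approx√-upper : ∀ a k →
  a ℚ.< (approx√ a k ℚ.+ mesh k) ℚ.* (approx√ a k ℚ.+ mesh k)
approx√-upper a k =
  subst (λ t → a ℚ.< t ℚ.* t) (suc⊙ (gridRoot a (mesh k) B) (mesh k))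
    (gridRoot-upper a (mesh k) B (ℚ.<-≤-trans (a<M² a) M²≤))
  where
  B = suc k ℕ.* suc ℤ.∣ ↥ a ∣
  M = + suc ℤ.∣ ↥ a ∣ / 1
  M≤ : M ℚ.≤ suc B ⊙ mesh k
  M≤ = subst₂ ℚ._≤_ (ℚ.+-identityʳ M)
         (sym (trans (suc⊙ B (mesh k)) (cong (ℚ._+ mesh k) (⊙-mesh k (suc ℤ.∣ ↥ a ∣)))))
         (ℚ.+-monoʳ-≤ M (ℚ.<⇒≤ (mesh>0 k)))
  0≤M : 0ℚ ℚ.≤ M
  0≤M = ℚ.≤-trans (ℚ.nonNegative⁻¹ 1ℚ) (1≤M ℤ.∣ ↥ a ∣)
  M²≤ : M ℚ.* M ℚ.≤ (suc B ⊙ mesh k) ℚ.* (suc B ⊙ mesh k)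
  M²≤ = *-mono-≤ (ℚ.≤-trans 0≤M M≤) 0≤M M≤ M≤

√-close : ∀ {a b δ h p r} → 0ℚ ℚ.< δ → 0ℚ ℚ.≤ r → 0ℚ ℚ.< h → h ℚ.< δ →
  p ℚ.* p ℚ.≤ a → a ℚ.< b ℚ.+ δ ℚ.* δ → b ℚ.< (r ℚ.+ h) ℚ.* (r ℚ.+ h) →
  p ℚ.< r ℚ.+ (δ ℚ.+ δ)
√-close {a} {b} {δ} {h} {p} {r} 0<δ 0≤r 0<h h<δ p²≤a a<b+δ² b<r+h² =
  square-cancel-< 0≤t
    (ℚ.≤-<-trans p²≤a
      (ℚ.<-≤-trans a<b+δ²
        (ℚ.≤-trans
          (ℚ.+-monoˡ-≤ (δ ℚ.* δ)
            (ℚ.≤-trans (ℚ.<⇒≤ b<r+h²) (*-mono-≤ 0≤u 0≤r+h r+h≤u r+h≤u)))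
          u²+δ²≤)))
  where
  u = r ℚ.+ δ
  t = r ℚ.+ (δ ℚ.+ δ)
  0≤δ = ℚ.<⇒≤ 0<δ
  0≤u : 0ℚ ℚ.≤ u
  0≤u = ℚ.+-mono-≤ 0≤r 0≤δ
  0≤t : 0ℚ ℚ.≤ t
  0≤t = ℚ.+-mono-≤ 0≤r (ℚ.+-mono-≤ 0≤δ 0≤δ)
  0≤r+h : 0ℚ ℚ.≤ r ℚ.+ h
  0≤r+h = ℚ.+-mono-≤ 0≤r (ℚ.<⇒≤ 0<h)
  r+h≤u : r ℚ.+ h ℚ.≤ u
  r+h≤u = ℚ.+-monoʳ-≤ r (ℚ.<⇒≤ h<δ)
  0≤2uδ : 0ℚ ℚ.≤ u ℚ.* δ ℚ.+ u ℚ.* δ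
  0≤2uδ = ℚ.+-mono-≤ 0≤uδ 0≤uδ
    where
    0≤uδ : 0ℚ ℚ.≤ u ℚ.* δ
    0≤uδ = subst (ℚ._≤ u ℚ.* δ) (ℚ.*-zeroˡ 0ℚ) (*-mono-≤ 0≤u ℚ.≤-refl 0≤u 0≤δ)
  u²+δ²≤ : u ℚ.* u ℚ.+ δ ℚ.* δ ℚ.≤ t ℚ.* t
  u²+δ²≤ = subst₂ ℚ._≤_ (ℚ.+-identityʳ _)
    (solve 2 (λ r d → (r :+ d) :* (r :+ d) :+ d :* d :+
                      ((r :+ d) :* d :+ (r :+ d) :* d)
                   := (r :+ (d :+ d)) :* (r :+ (d :+ d))) refl r δ)
    (ℚ.+-monoʳ-≤ (u ℚ.* u ℚ.+ δ ℚ.* δ) 0≤2uδ)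

⊔0-< : ∀ {x y ε} → 0ℚ ℚ.< ε → x ℚ.< y ℚ.+ ε → x ℚ.⊔ 0ℚ ℚ.< (y ℚ.⊔ 0ℚ) ℚ.+ ε
⊔0-< {x} {y} {ε} 0<ε x<y+ε with ℚ.⊔-sel x 0ℚ
... | inj₁ eq = subst (ℚ._< _) (sym eq)
      (ℚ.<-≤-trans x<y+ε (ℚ.+-monoˡ-≤ ε (ℚ.p≤p⊔q y 0ℚ)))
... | inj₂ eq = subst (ℚ._< _) (sym eq)
      (ℚ.+-mono-≤-< (ℚ.p≤q⊔p y 0ℚ) 0<ε)

approx√⁺ : (ℕ → ℚ) → ℕ → ℚ
approx√⁺ x n = approx√ (x n ℚ.⊔ 0ℚ) n

√-cauchy : ∀ x → IsCauchy x → IsCauchy (approx√⁺ x)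
√-cauchy x x-cauchy ε 0<ε =
  fromModuli (x-cauchy (δ ℚ.* δ) (0<* 0<δ 0<δ)) (mesh-small δ 0<δ)
  where
  δ = ½ ℚ.* ε
  0<δ : 0ℚ ℚ.< δ
  0<δ = 0<½* 0<ε
  fromModuli :
    (∃[ M ] ∀ m n → M ℕ.≤ m → M ℕ.≤ n → ℚ.∣ x m ℚ.- x n ∣ ℚ.< δ ℚ.* δ) →
    (∃[ N ] ∀ k → N ℕ.≤ k → mesh k ℚ.< δ) →
    ∃[ N ] ∀ m n → N ℕ.≤ m → N ℕ.≤ n →
      ℚ.∣ approx√⁺ x m ℚ.- approx√⁺ x n ∣ ℚ.< ε
  fromModuli (M , f) (N , g) =
    M ℕ.⊔ N , λ m n p q → ∣-∣-< (half m n p q) (half n m q p)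
    where
    half : ∀ m n → M ℕ.⊔ N ℕ.≤ m → M ℕ.⊔ N ℕ.≤ n →
           approx√⁺ x m ℚ.< approx√⁺ x n ℚ.+ ε
    half m n p q = subst (λ t → approx√⁺ x m ℚ.< approx√⁺ x n ℚ.+ t) (½+½ ε)
      (√-close 0<δ (approx√-nonneg (x n ℚ.⊔ 0ℚ) n) (mesh>0 n)
        (g n (ℕ.m⊔n≤o⇒n≤o M N q))
        (approx√-lower (x m ℚ.⊔ 0ℚ) m (ℚ.p≤q⊔p (x m) 0ℚ))
        (⊔0-< {x m} {x n} (0<* 0<δ 0<δ)
          (∣-∣-<⇒< {x m} {x n}
            (f m n (ℕ.m⊔n≤o⇒m≤o M N p) (ℕ.m⊔n≤o⇒m≤o M N q))))
        (approx√-upper (x n ℚ.⊔ 0ℚ) n))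

-- Total square root; negative arguments are sent to 0.
√_ : ℝ → ℝ
√ x = mkℝ (approx√⁺ (seq x)) (√-cauchy (seq x) (cauchy x))

+-0-rawMonoid : RawMonoid _ _
+-0-rawMonoid = record { Carrier = ℝ ; _≈_ = _≈_ ; _∙_ = _+_ ; ε = 0ℝ }

open RawMonoidDefs +-0-rawMonoid public using (sum)

Matrix : ℕ → Set
Matrix n = Fin n → Fin n → ℝ

infixr 7 _·_
infix  4 _≈ᵥ_

_·_ : ∀ {n} → Matrix n → Vector ℝ n → Vector ℝ n
(A · v) r = sum λ c → A r c * v c

_≈ᵥ_ : ∀ {n} → Vector ℝ n → Vector ℝ n → Set
v ≈ᵥ w = ∀ r → v r ≈ w r

combination : ∀ {m n} → Vector ℝ m → Vector (Vector ℝ n) m → Vector ℝ n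
combination c v r = sum λ k → c k * v k r

LinearlyIndependent : ∀ {m n} → Vector (Vector ℝ n) m → Set
LinearlyIndependent v = ∀ c → combination c v ≈ᵥ (λ _ → 0ℝ) → ∀ k → c k ≈ 0ℝ

Spanning : ∀ {m n} → Vector (Vector ℝ n) m → Set
Spanning v = ∀ w → ∃[ c ] combination c v ≈ᵥ w

IsBasis : ∀ {m n} → Vector (Vector ℝ n) m → Set
IsBasis v = LinearlyIndependent v × Spanning v

-- The family ev lists the eigenvalues of A in non-increasing order, each as
-- often as the dimension of its eigenspace.  For the symmetric matrices used
-- here this is also its multiplicity as a root of the characteristic
-- polynomial.
IsSpectrum : ∀ {n} → Matrix n → Vector ℝ n → Set
IsSpectrum {n} A ev =
  (∀ k l → k Fin.≤ l → ev l ≤ ev k) ×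
  ∃[ v ] IsBasis v × (∀ (k : Fin n) → A · v k ≈ᵥ λ r → ev k * v k r)

record Graph (n : ℕ) : Set where
  field
    adj       : Fin n → Fin n → Bool
    symmetric : ∀ u v → adj u v ≡ adj v u
    loopless  : ∀ u → adj u u ≡ false

open Graph public

complement : ∀ {n} → Graph n → Graph n
adj (complement G) u v = not (adj G u v) ∧ not (does (u Fin.≟ v))
symmetric (complement G) u v
  rewrite symmetric G u v = cong (λ b → not (adj G v u) ∧ not b) (≟-sym u v)
  where
  ≟-sym : ∀ {n} (u v : Fin n) → does (u Fin.≟ v) ≡ does (v Fin.≟ u)
  ≟-sym u v with u Fin.≟ v | v Fin.≟ u
  ... | yes _    | yes _    = refl
  ... | no  _    | no  _    = refl
  ... | yes refl | no  v≢v  = contradiction refl v≢v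
  ... | no  v≢v  | yes refl = contradiction refl v≢v
loopless (complement G) u
  rewrite dec-true (u Fin.≟ u) refl = ∧-zeroʳ (not (adj G u u))

adjacencyMatrix : ∀ {n} → Graph n → Matrix n
adjacencyMatrix G u v = if adj G u v then 1ℝ else 0ℝ

-- Families over Fin n are indexed from 0, so λ_{n-i+1} has index n - i.
fromBottom : ∀ {n} i .{{_ : NonZero i}} → i ℕ.≤ n → Fin n
fromBottom i i≤n = fromℕ< (ℕ.∸-monoʳ-< (ℕ.>-nonZero⁻¹ i) i≤n)

-- x = λ_{n-i+1}(G) + λ_{n-j+1}(complement of G)
IsEigenvalueSum : ∀ {n} i j .{{_ : NonZero i}} .{{_ : NonZero j}} →
                  i ℕ.≤ n → j ℕ.≤ n → Graph n → ℝ → Set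
IsEigenvalueSum i j i≤n j≤n G x =
  ∃[ ev ] ∃[ ev′ ]
    IsSpectrum (adjacencyMatrix G) ev ×
    IsSpectrum (adjacencyMatrix (complement G)) ev′ ×
    x ≈ ev (fromBottom i i≤n) + ev′ (fromBottom j j≤n)

IsMinimum : (ℝ → Set) → ℝ → Set
IsMinimum P m = P m × (∀ x → P x → m ≤ x)

infix 4 _⟶_

_⟶_ : (ℕ → ℝ) → ℝ → Set
f ⟶ ℓ = ∀ ε → 0ℝ < ε → ∃[ N ] ∀ n → N ℕ.≤ n → ∣ f n - ℓ ∣ < ε

-- 1/n, with the value at n = 0 irrelevant for limits.
recip : ℕ → ℝ
recip zero    = 0ℝ
recip (suc n) = fromℚ (+ 1 / suc n)

-- β = β_{i,j}.  The values of m at n < max i j, where the eigenvalues are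
-- not defined, are arbitrary.
Isβ : ∀ i j .{{_ : NonZero i}} .{{_ : NonZero j}} → ℝ → Set
Isβ i j β =
  Σ[ m ∈ (ℕ → ℝ) ]
    (∀ n (i≤n : i ℕ.≤ n) (j≤n : j ℕ.≤ n) →
      IsMinimum (λ x → ∃[ G ] IsEigenvalueSum i j i≤n j≤n G x) (m n)) ×
    (λ n → recip n * m n) ⟶ β

-- Let S = A - Ā for a graph on n vertices and its complement, so that ⟪S,S⟫ ≤ n².
-- As A + Ā + I = J is positive semidefinite, every unit vector u satisfies
-- u·Su ≤ 2 u·Au + 1 and -u·Su ≤ 2 u·Āu + 1.  Let P and Q project onto the spans
-- of the bottom i eigenvectors of A and the bottom j eigenvectors of Ā, and let
-- λ, λ̄ be the largest of the corresponding eigenvalues.  Then T = P/i - Q/j has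
-- ⟪T,T⟫ ≤ 1/i + 1/j because ⟪P,Q⟫ ≥ 0, and ⟪S,T⟫ ≤ 2 (λ + λ̄) + 2, so Cauchy–Schwarz
-- gives λ + λ̄ ≥ -(n/2) √(1/i + 1/j) - 1.  In the other direction, if k² + i ≤ n then
-- the projector R onto the span of the top k² eigenvectors of A has
-- k² λ ≤ ⟪A,R⟫ ≤ n k, hence λ ≤ n/k, and likewise for λ̄; therefore β ≤ 0.

module Submission where

open import Algebra.Bundles using (CommutativeRing)
import Algebra.Properties.Semiring.Sum
open import Algebra.Solver.Ring.AlmostCommutativeRing
  using (fromCommutativeRing; _-Raw-AlmostCommutative⟶_)
import Algebra.Solver.Ring as RingSolver
open import Data.Bool.Base using (true; false; not; _∧_; if_then_else_)
open import Data.Fin.Base as Fin using (Fin; zero; suc; toℕ; _↑ʳ_; inject≤)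
open import Data.Fin.Properties as Fin using (_≟_)
open import Data.Maybe.Base as Maybe using (Maybe)
open import Data.Nat.Base as ℕ using (zero; suc)
import Data.Nat.Properties as ℕ
open import Data.Product.Base using (∃-syntax; _×_; _,_; proj₁; proj₂)
open import Data.Rational.Base as ℚ using (ℚ; 0ℚ; 1ℚ)
import Data.Rational.Properties as ℚ
open import Data.Rational.Solver using (module +-*-Solver)
open import Data.Sum.Base using (_⊎_; inj₁; inj₂)
open import Data.Vec.Functional using (Vector; _∷_; tail)
open import Function.Base using (_∘_)
open import Function.Definitions using (Injective)
open import Level using (0ℓ)
open import Relation.Binary.Bundles using (Poset)
open import Relation.Binary.Core using (Rel)
open import Relation.Binary.PropositionalEquality as ≡ using (_≡_)
open import Relation.Binary.Structures using (IsPartialOrder)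
open import Relation.Nullary.Decidable using (does; yes; no; dec⇒maybe; dec-true; dec-false)
open import Relation.Nullary.Negation using (¬_; contradiction)

open import Data.Nat.Base using (ℕ; NonZero)
open import Data.Integer.Base using (+_)
open import Data.Rational.Base using (½; _/_) renaming (_+_ to _+ℚ_)

-- Equality and order of Cauchy reals are undecidable, and the eigenbasis in `IsSpectrum` is only
-- linearly independent. It cannot be orthogonalised one eigenspace at a time, because coincidences
-- among eigenvalues cannot be detected. Two devices get around this. The Rayleigh bound is proved
-- for arbitrary combinations of eigenvectors, so orthonormalising a chosen subfamily only has to
-- stay inside its span. And `_≤_` is stable under double negation, so an orthonormal family that
-- exists only classically may be used as long as an inequality is being proved. The weights 1/i and
-- 1/j in T turn the sums of i and j Rayleigh quotients into averages, which is why λ and λ̄ enter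
-- ⟪S,T⟫ with the same coefficient. The rank k² of R is a perfect square so that its Frobenius norm
-- is the integer k.

-- Inverses are only required up to double negation: with stable inequalities
-- this suffices for Gram–Schmidt whenever the goal is an inequality.
record EuclideanField : Set₁ where
  field
    commutativeRing : CommutativeRing 0ℓ 0ℓ
  open CommutativeRing commutativeRing public
  infix 4 _≤_
  field
    _≤_            : Rel Carrier 0ℓ
    isPartialOrder : IsPartialOrder _≈_ _≤_
    ≤-stable       : ∀ {x y} → ¬ ¬ (x ≤ y) → x ≤ y
    +-mono-≤       : ∀ {w x y z} → w ≤ x → y ≤ z → w + y ≤ x + z
    *-nonneg       : ∀ {x y} → 0# ≤ x → 0# ≤ y → 0# ≤ x * y
    square-nonneg  : ∀ x → 0# ≤ x * x
    sqrt           : ∀ {x} → 0# ≤ x → ∃[ s ] 0# ≤ s × s * s ≈ x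
    1≉0            : ¬ (1# ≈ 0#)
    invert         : ∀ {x} → ¬ (x ≈ 0#) → ¬ ¬ (∃[ y ] x * y ≈ 1#)
    -- The ring solver needs coefficients with decidable equality, which the carrier lacks. The
    -- rationals serve, and they also provide constants such as ½.
    ℚ-morphism     : ℚ.+-*-rawRing -Raw-AlmostCommutative⟶ fromCommutativeRing commutativeRing

  poset : Poset 0ℓ 0ℓ 0ℓ
  poset = record { isPartialOrder = isPartialOrder }

  open IsPartialOrder isPartialOrder public
    using () renaming (reflexive to ≤-reflexive; trans to ≤-trans; antisym to ≤-antisym)

  open _-Raw-AlmostCommutative⟶_ ℚ-morphism public using (⟦_⟧)

  private
    coefficient≟ : ∀ p q → Maybe (⟦ p ⟧ ≈ ⟦ q ⟧)
    coefficient≟ p q = Maybe.map (reflexive ∘ ≡.cong ⟦_⟧) (dec⇒maybe (p ℚ.≟ q))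

  open RingSolver ℚ.+-*-rawRing (fromCommutativeRing commutativeRing) ℚ-morphism coefficient≟ public
    using (solve; con; _:=_; _:+_; _:*_; _:-_; :-_)

-- Linear algebra over a Euclidean field

module LinearAlgebra (F : EuclideanField) where

  open EuclideanField F hiding (zero)
  private
    module Sum = Algebra.Properties.Semiring.Sum semiring

    variable
      l m n : ℕ

  open import Relation.Binary.Reasoning.PartialOrder poset

  -- The library's sum is a fold that unfolds during unification and hides the
  -- length and the summand, so it is sealed.
  opaque
    ∑ : Vector Carrier n → Carrier
    ∑ = Sum.sum

    ∑≡sum : ∀ (f : Vector Carrier n) → ∑ f ≡ Sum.sum f
    ∑≡sum f = ≡.refl

    ∑-[] : ∀ (f : Vector Carrier 0) → ∑ f ≈ 0#
    ∑-[] f = refl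

    ∑-∷ : ∀ (f : Vector Carrier (suc n)) → ∑ f ≈ f zero + ∑ (f ∘ suc)
    ∑-∷ f = refl

    ∑-cong : ∀ {f g : Vector Carrier n} → (∀ k → f k ≈ g k) → ∑ f ≈ ∑ g
    ∑-cong = Sum.sum-cong-≋

    ∑-zero : ∑ {n} (λ _ → 0#) ≈ 0#
    ∑-zero {n} = Sum.sum-replicate-zero n

    ∑-+ : ∀ (f g : Vector Carrier n) → ∑ (λ k → f k + g k) ≈ ∑ f + ∑ g
    ∑-+ = Sum.∑-distrib-+

    ∑-comm : ∀ (f : Fin m → Fin n → Carrier) →
             ∑ (λ k → ∑ λ l → f k l) ≈ ∑ (λ l → ∑ λ k → f k l)
    ∑-comm = Sum.∑-comm

    *-distribˡ-∑ : ∀ x (f : Vector Carrier n) → x * ∑ f ≈ ∑ λ k → x * f k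
    *-distribˡ-∑ = Sum.*-distribˡ-sum

    *-distribʳ-∑ : ∀ x (f : Vector Carrier n) → ∑ f * x ≈ ∑ λ k → f k * x
    *-distribʳ-∑ = Sum.*-distribʳ-sum

  -- Ordered-field arithmetic

  ≤-refl : ∀ {x} → x ≤ x
  ≤-refl = ≤-reflexive refl

  +-monoˡ-≤ : ∀ {x y} z → x ≤ y → x + z ≤ y + z
  +-monoˡ-≤ z x≤y = +-mono-≤ x≤y ≤-refl

  +-monoʳ-≤ : ∀ {x y} z → x ≤ y → z + x ≤ z + y
  +-monoʳ-≤ z = +-mono-≤ ≤-refl

  x≤y⇒0≤y-x : ∀ {x y} → x ≤ y → 0# ≤ y - x
  x≤y⇒0≤y-x {x} {y} x≤y = begin
    0#     ≈⟨ -‿inverseʳ x ⟨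
    x - x  ≤⟨ +-monoˡ-≤ (- x) x≤y ⟩
    y - x  ∎

  0≤y-x⇒x≤y : ∀ {x y} → 0# ≤ y - x → x ≤ y
  0≤y-x⇒x≤y {x} {y} 0≤y-x = begin
    x          ≈⟨ +-identityˡ x ⟨
    0# + x     ≤⟨ +-monoˡ-≤ x 0≤y-x ⟩
    y - x + x  ≈⟨ solve 2 (λ x y → y :- x :+ x := y) refl x y ⟩
    y          ∎

  x≤x+y : ∀ {y} x → 0# ≤ y → x ≤ x + y
  x≤x+y {y} x 0≤y = begin
    x       ≈⟨ +-identityʳ x ⟨
    x + 0#  ≤⟨ +-monoʳ-≤ x 0≤y ⟩
    x + y   ∎

  *-monoˡ-≤ : ∀ {x y z} → 0# ≤ z → x ≤ y → z * x ≤ z * y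
  *-monoˡ-≤ {x} {y} {z} 0≤z x≤y = 0≤y-x⇒x≤y (begin
    0#             ≤⟨ *-nonneg 0≤z (x≤y⇒0≤y-x x≤y) ⟩
    z * (y - x)    ≈⟨ solve 3 (λ x y z → z :* (y :- x) := z :* y :- z :* x) refl x y z ⟩
    z * y - z * x  ∎)

  -- The goal is stable, so an inverse of `z` may be assumed; it is nonnegative because it equals
  -- `z * (z⁻¹ * z⁻¹)`.
  *-cancelˡ-≤ : ∀ {x y z} → 0# ≤ z → ¬ z ≈ 0# → z * x ≤ z * y → x ≤ y
  *-cancelˡ-≤ {x} {y} {z} 0≤z z≉0 zx≤zy =
    ≤-stable λ x≰y → invert z≉0 λ (z⁻¹ , zz⁻¹≈1) → x≰y (begin
      x               ≈⟨ unscale z⁻¹ zz⁻¹≈1 x ⟨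
      z⁻¹ * (z * x)   ≤⟨ *-monoˡ-≤ (0≤z⁻¹ z⁻¹ zz⁻¹≈1) zx≤zy ⟩
      z⁻¹ * (z * y)   ≈⟨ unscale z⁻¹ zz⁻¹≈1 y ⟩
      y               ∎)
    where
    unscale : ∀ z⁻¹ → z * z⁻¹ ≈ 1# → ∀ x → z⁻¹ * (z * x) ≈ x
    unscale z⁻¹ zz⁻¹≈1 x = begin-equality
      z⁻¹ * (z * x)  ≈⟨ solve 3 (λ z y x → y :* (z :* x) := (z :* y) :* x) refl z z⁻¹ x ⟩
      (z * z⁻¹) * x  ≈⟨ *-congʳ zz⁻¹≈1 ⟩
      1# * x         ≈⟨ *-identityˡ x ⟩
      x              ∎
    0≤z⁻¹ : ∀ z⁻¹ → z * z⁻¹ ≈ 1# → 0# ≤ z⁻¹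
    0≤z⁻¹ z⁻¹ zz⁻¹≈1 = begin
      0#               ≤⟨ *-nonneg 0≤z (square-nonneg z⁻¹) ⟩
      z * (z⁻¹ * z⁻¹)  ≈⟨ *-assoc z z⁻¹ z⁻¹ ⟨
      z * z⁻¹ * z⁻¹    ≈⟨ *-congʳ zz⁻¹≈1 ⟩
      1# * z⁻¹         ≈⟨ *-identityˡ z⁻¹ ⟩
      z⁻¹              ∎

  ≈-stable : ∀ {x y} → ¬ ¬ (x ≈ y) → x ≈ y
  ≈-stable ¬x≉y = ≤-antisym
    (≤-stable λ x≰y → ¬x≉y λ x≈y → x≰y (≤-reflexive x≈y))
    (≤-stable λ y≰x → ¬x≉y λ x≈y → y≰x (≤-reflexive (sym x≈y)))

  -- By stability of equality `x` may be taken nonzero, hence invertible; then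
  -- `1# = (x y)² = x² y² = 0#`.
  square≈0 : ∀ {x} → x * x ≈ 0# → x ≈ 0#
  square≈0 {x} xx≈0 = ≈-stable λ x≉0 → invert x≉0 λ (y , xy≈1) → 1≉0 (begin-equality
    1#                 ≈⟨ *-identityˡ 1# ⟨
    1# * 1#            ≈⟨ *-cong xy≈1 xy≈1 ⟨
    (x * y) * (x * y)  ≈⟨ solve 2 (λ x y → (x :* y) :* (x :* y) := (x :* x) :* (y :* y)) refl x y ⟩
    (x * x) * (y * y)  ≈⟨ *-congʳ xx≈0 ⟩
    0# * (y * y)       ≈⟨ zeroˡ (y * y) ⟩
    0#                 ∎)

  nonneg-+≈0 : ∀ {x y} → 0# ≤ x → 0# ≤ y → x + y ≈ 0# → x ≈ 0# × y ≈ 0#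
  nonneg-+≈0 {x} {y} 0≤x 0≤y x+y≈0 =
    ≤-antisym (≤-trans (x≤x+y x 0≤y) (≤-reflexive x+y≈0)) 0≤x ,
    ≤-antisym (≤-trans (x≤x+y y 0≤x) (≤-reflexive (trans (+-comm y x) x+y≈0))) 0≤y

  -- With h = (x - y) z the hypothesis says (x + y) h = 0, so x h² and y h²
  -- vanish, and h⁴ = z h (x h² - y h²).
  square-difference : ∀ {x y z} → 0# ≤ x → 0# ≤ y →
                      (x * x - y * y) * z ≈ 0# → (x - y) * z ≈ 0#
  square-difference {x} {y} {z} 0≤x 0≤y eq = square≈0 (square≈0 (begin-equality
    (h * h) * (h * h)
      ≈⟨ solve 3 (λ x y z → let h = (x :- y) :* z in
           (h :* h) :* (h :* h) := (z :* h) :* (x :* (h :* h) :- y :* (h :* h))) refl x y z ⟩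
    (z * h) * (x * (h * h) - y * (h * h))
      ≈⟨ *-congˡ (+-cong (proj₁ both) (-‿cong (proj₂ both))) ⟩
    (z * h) * (0# - 0#)
      ≈⟨ trans (*-congˡ (-‿inverseʳ 0#)) (zeroʳ (z * h)) ⟩
    0# ∎))
    where
    h = (x - y) * z
    both : x * (h * h) ≈ 0# × y * (h * h) ≈ 0#
    both = nonneg-+≈0 (*-nonneg 0≤x (square-nonneg h)) (*-nonneg 0≤y (square-nonneg h))
      (begin-equality
        x * (h * h) + y * (h * h)
          ≈⟨ solve 3 (λ x y z → let h = (x :- y) :* z in
               x :* (h :* h) :+ y :* (h :* h) := ((x :* x :- y :* y) :* z) :* h) refl x y z ⟩
        ((x * x - y * y) * z) * h
          ≈⟨ trans (*-congʳ eq) (zeroˡ h) ⟩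
        0# ∎)

  -- Finite sums and the Kronecker delta

  ∑-mono-≤ : ∀ {f g : Vector Carrier n} → (∀ k → f k ≤ g k) → ∑ f ≤ ∑ g
  ∑-mono-≤ {zero}  {f} {g} f≤g = ≤-reflexive (trans (∑-[] f) (sym (∑-[] g)))
  ∑-mono-≤ {suc n} {f} {g} f≤g = begin
    ∑ f                    ≈⟨ ∑-∷ f ⟩
    f zero + ∑ (f ∘ suc)   ≤⟨ +-mono-≤ (f≤g zero) (∑-mono-≤ (f≤g ∘ suc)) ⟩
    g zero + ∑ (g ∘ suc)   ≈⟨ ∑-∷ g ⟨
    ∑ g                    ∎

  ∑-nonneg : ∀ {f : Vector Carrier n} → (∀ k → 0# ≤ f k) → 0# ≤ ∑ f
  ∑-nonneg 0≤f = ≤-trans (≤-reflexive (sym ∑-zero)) (∑-mono-≤ 0≤f)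

  nonneg-∑≈0 : ∀ {f : Vector Carrier n} → (∀ k → 0# ≤ f k) → ∑ f ≈ 0# → ∀ k → f k ≈ 0#
  nonneg-∑≈0 {f = f} 0≤f eq zero =
    proj₁ (nonneg-+≈0 (0≤f zero) (∑-nonneg (0≤f ∘ suc)) (trans (sym (∑-∷ f)) eq))
  nonneg-∑≈0 {f = f} 0≤f eq (suc k) = nonneg-∑≈0 (0≤f ∘ suc)
    (proj₂ (nonneg-+≈0 (0≤f zero) (∑-nonneg (0≤f ∘ suc)) (trans (sym (∑-∷ f)) eq))) k

  ∑-linear : ∀ a (f g : Vector Carrier n) →
               ∑ (λ k → a * f k + g k) ≈ a * ∑ f + ∑ g
  ∑-linear a f g =
    trans (∑-+ (λ k → a * f k) g) (+-congʳ (sym (*-distribˡ-∑ a f)))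

  -- The identity matrix, written with the same test `does (k ≟ l)` that removes loops in
  -- `complement`, so that one case split settles both.
  δ : Fin n → Fin n → Carrier
  δ k l = if does (k ≟ l) then 1# else 0#

  ∑-δ : ∀ (k : Fin n) (f : Vector Carrier n) → ∑ (λ l → δ k l * f l) ≈ f k
  ∑-δ zero f = begin-equality
    ∑ (λ l → δ zero l * f l)                ≈⟨ ∑-∷ _ ⟩
    1# * f zero + ∑ (λ l → 0# * f (suc l))
      ≈⟨ +-cong (*-identityˡ _) (trans (∑-cong λ l → zeroˡ (f (suc l))) ∑-zero) ⟩
    f zero + 0#                             ≈⟨ +-identityʳ _ ⟩
    f zero                                  ∎
  ∑-δ (suc k) f = begin-equality
    ∑ (λ l → δ (suc k) l * f l)                ≈⟨ ∑-∷ _ ⟩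
    0# * f zero + ∑ (λ l → δ k l * f (suc l))  ≈⟨ +-cong (zeroˡ _) (∑-δ k (f ∘ suc)) ⟩
    0# + f (suc k)                             ≈⟨ +-identityˡ _ ⟩
    f (suc k)                                  ∎

  δ-sym : ∀ (k l : Fin n) → δ k l ≡ δ l k
  δ-sym zero    zero    = ≡.refl
  δ-sym zero    (suc l) = ≡.refl
  δ-sym (suc k) zero    = ≡.refl
  δ-sym (suc k) (suc l) = δ-sym k l

  δ-refl : ∀ (k : Fin n) → δ k k ≡ 1#
  δ-refl zero    = ≡.refl
  δ-refl (suc k) = δ-refl k

  δ-injective : ∀ (ι : Fin m → Fin n) → Injective _≡_ _≡_ ι → ∀ k l → δ (ι k) (ι l) ≡ δ k l
  δ-injective ι inj k l with k ≟ l
  ... | yes k≡l = ≡.cong (if_then 1# else 0#) (dec-true (ι k ≟ ι l) (≡.cong ι k≡l))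
  ... | no  k≢l = ≡.cong (if_then 1# else 0#) (dec-false (ι k ≟ ι l) (k≢l ∘ inj))

  δ-square : ∀ (k l : Fin n) → δ k l * δ k l ≈ δ k l
  δ-square zero    zero    = *-identityˡ 1#
  δ-square zero    (suc l) = zeroˡ 0#
  δ-square (suc k) zero    = zeroˡ 0#
  δ-square (suc k) (suc l) = δ-square k l

  -- Vectors, inner products and linear combinations

  infix 4 _≈ᵥ_
  infix 7 _∙_
  infixr 7 _·_

  _≈ᵥ_ : Vector Carrier n → Vector Carrier n → Set
  v ≈ᵥ w = ∀ r → v r ≈ w r

  _∙_ : Vector Carrier n → Vector Carrier n → Carrier
  v ∙ w = ∑ λ r → v r * w r

  ∙-comm : ∀ (v w : Vector Carrier n) → v ∙ w ≈ w ∙ v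
  ∙-comm v w = ∑-cong λ r → *-comm (v r) (w r)

  ∙-cong : ∀ {v v′ w w′ : Vector Carrier n} → v ≈ᵥ v′ → w ≈ᵥ w′ → v ∙ w ≈ v′ ∙ w′
  ∙-cong v≈v′ w≈w′ = ∑-cong λ r → *-cong (v≈v′ r) (w≈w′ r)

  ∙-linearˡ : ∀ a (v w z : Vector Carrier n) → (λ r → a * v r + w r) ∙ z ≈ a * (v ∙ z) + w ∙ z
  ∙-linearˡ a v w z = begin-equality
    ∑ (λ r → (a * v r + w r) * z r)
      ≈⟨ (∑-cong λ r → solve 4 (λ a v w z → (a :* v :+ w) :* z := a :* (v :* z) :+ w :* z)
           refl a (v r) (w r) (z r)) ⟩
    ∑ (λ r → a * (v r * z r) + w r * z r)
      ≈⟨ ∑-linear a _ _ ⟩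
    a * (v ∙ z) + w ∙ z ∎

  ∙-scaleˡ : ∀ a (v z : Vector Carrier n) → (λ r → a * v r) ∙ z ≈ a * (v ∙ z)
  ∙-scaleˡ a v z = trans (∑-cong λ r → *-assoc a (v r) (z r)) (sym (*-distribˡ-∑ a _))

  ∙-nonneg : ∀ (v : Vector Carrier n) → 0# ≤ v ∙ v
  ∙-nonneg v = ∑-nonneg λ r → square-nonneg (v r)

  ∙-definite : ∀ (v : Vector Carrier n) → v ∙ v ≈ 0# → v ≈ᵥ (λ _ → 0#)
  ∙-definite v eq r = square≈0 (nonneg-∑≈0 (λ r → square-nonneg (v r)) eq r)

  combination : Vector Carrier m → Vector (Vector Carrier n) m → Vector Carrier n
  combination c v r = ∑ λ k → c k * v k r

  combination-∙ : ∀ c (v : Vector (Vector Carrier n) m) z →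
                  combination c v ∙ z ≈ ∑ λ k → c k * (v k ∙ z)
  combination-∙ c v z = begin-equality
    ∑ (λ r → ∑ (λ k → c k * v k r) * z r)
      ≈⟨ (∑-cong λ r → *-distribʳ-∑ (z r) _) ⟩
    ∑ (λ r → ∑ λ k → c k * v k r * z r)
      ≈⟨ ∑-comm _ ⟩
    ∑ (λ k → ∑ λ r → c k * v k r * z r)
      ≈⟨ (∑-cong λ k → trans (∑-cong λ r → *-assoc (c k) _ _) (sym (*-distribˡ-∑ (c k) _))) ⟩
    ∑ (λ k → c k * (v k ∙ z)) ∎

  combination-∙-combination : ∀ a b (v : Vector (Vector Carrier n) m) →
    combination a v ∙ combination b v ≈ ∑ λ k → ∑ λ l → (a k * b l) * (v k ∙ v l)
  combination-∙-combination a b v = begin-equality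
    combination a v ∙ combination b v
      ≈⟨ combination-∙ a v (combination b v) ⟩
    ∑ (λ k → a k * (v k ∙ combination b v))
      ≈⟨ (∑-cong λ k → *-congˡ (trans (∙-comm (v k) _) (combination-∙ b v (v k)))) ⟩
    ∑ (λ k → a k * ∑ λ l → b l * (v l ∙ v k))
      ≈⟨ (∑-cong λ k → *-distribˡ-∑ (a k) _) ⟩
    ∑ (λ k → ∑ λ l → a k * (b l * (v l ∙ v k)))
      ≈⟨ (∑-cong λ k → ∑-cong λ l →
           trans (sym (*-assoc (a k) (b l) _)) (*-congˡ (∙-comm (v l) (v k)))) ⟩
    ∑ (λ k → ∑ λ l → (a k * b l) * (v k ∙ v l)) ∎

  combination-combination : ∀ a (C : Fin l → Vector Carrier m) (v : Vector (Vector Carrier n) m) →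
    combination a (λ k → combination (C k) v) ≈ᵥ combination (λ l → ∑ λ k → a k * C k l) v
  combination-combination a C v r = begin-equality
    ∑ (λ k → a k * ∑ λ l → C k l * v l r)
      ≈⟨ (∑-cong λ k → trans (*-distribˡ-∑ (a k) _)
           (∑-cong λ l → sym (*-assoc (a k) (C k l) (v l r)))) ⟩
    ∑ (λ k → ∑ λ l → a k * C k l * v l r)
      ≈⟨ ∑-comm _ ⟩
    ∑ (λ l → ∑ λ k → a k * C k l * v l r)
      ≈⟨ (∑-cong λ l → *-distribʳ-∑ (v l r) _) ⟨
    ∑ (λ l → (∑ λ k → a k * C k l) * v l r) ∎

  -- Symmetric matrices and the Rayleigh bound

  Matrix : ℕ → Set
  Matrix n = Fin n → Fin n → Carrier

  Symmetric : Matrix n → Set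
  Symmetric A = ∀ r c → A r c ≈ A c r

  _·_ : Matrix n → Vector Carrier n → Vector Carrier n
  (A · v) r = A r ∙ v

  ·-self-adjoint : ∀ {A : Matrix n} → Symmetric A → ∀ v w → v ∙ (A · w) ≈ (A · v) ∙ w
  ·-self-adjoint {A = A} A-sym v w = begin-equality
    ∑ (λ r → v r * ∑ λ c → A r c * w c)
      ≈⟨ (∑-cong λ r → *-distribˡ-∑ (v r) _) ⟩
    ∑ (λ r → ∑ λ c → v r * (A r c * w c))
      ≈⟨ ∑-comm _ ⟩
    ∑ (λ c → ∑ λ r → v r * (A r c * w c))
      ≈⟨ (∑-cong λ c → ∑-cong λ r → trans (*-congˡ (*-congʳ (A-sym r c)))
           (solve 3 (λ v a w → v :* (a :* w) := a :* v :* w) refl (v r) (A c r) (w c))) ⟩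
    ∑ (λ c → ∑ λ r → A c r * v r * w c)
      ≈⟨ (∑-cong λ c → *-distribʳ-∑ (w c) _) ⟨
    ∑ (λ c → (∑ λ r → A c r * v r) * w c) ∎

  ·-combination : ∀ (A : Matrix n) c (v : Vector (Vector Carrier n) m) →
                  A · combination c v ≈ᵥ combination c (λ k → A · v k)
  ·-combination A c v r = begin-equality
    A r ∙ combination c v            ≈⟨ ∙-comm (A r) _ ⟩
    combination c v ∙ A r            ≈⟨ combination-∙ c v (A r) ⟩
    ∑ (λ k → c k * (v k ∙ A r))    ≈⟨ (∑-cong λ k → *-congˡ (∙-comm (v k) (A r))) ⟩
    ∑ (λ k → c k * (A r ∙ v k))    ∎

  Eigenfamily : Matrix n → Vector Carrier m → Vector (Vector Carrier n) m → Set
  Eigenfamily A μ v = ∀ k → A · v k ≈ᵥ λ r → μ k * v k r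

  -- The eigenvectors need not be orthogonal, but (μ_k - μ_l) (v_k ∙ v_l) = 0.
  -- Hence w = Σ c_k √(x - μ_k) v_k satisfies w ∙ w = x (u ∙ u) - u ∙ A u.
  rayleigh : ∀ {A : Matrix n} {μ} {v : Vector (Vector Carrier n) m} {x} → Symmetric A →
             Eigenfamily A μ v → (∀ k → μ k ≤ x) → ∀ c →
             let u = combination c v in u ∙ (A · u) ≤ x * (u ∙ u)
  rayleigh {n} {m} {A} {μ} {v} {x} A-sym eig μ≤x c = begin
    u ∙ (A · u)                                  ≤⟨ x≤x+y _ (∙-nonneg w) ⟩
    u ∙ (A · u) + w ∙ w                          ≈⟨ +-congˡ w∙w≈u∙z ⟩
    u ∙ (A · u) + u ∙ z                          ≈⟨ +-cong (∙-comm u _) (∙-comm u z) ⟩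
    (A · u) ∙ u + z ∙ u                          ≈⟨ +-congʳ (*-identityˡ _) ⟨
    1# * ((A · u) ∙ u) + z ∙ u                   ≈⟨ ∙-linearˡ 1# (A · u) z u ⟨
    (λ r → 1# * (A · u) r + z r) ∙ u             ≈⟨ ∙-cong Au+z≈xu (λ _ → refl) ⟩
    (λ r → x * u r) ∙ u                          ≈⟨ ∙-scaleˡ x u u ⟩
    x * (u ∙ u)                                  ∎
    where
    u = combination c v
    root : ∀ k → ∃[ s ] 0# ≤ s × s * s ≈ x - μ k
    root k = sqrt (x≤y⇒0≤y-x (μ≤x k))
    s : Vector Carrier m
    s k = proj₁ (root k)
    s² : ∀ k → s k * s k ≈ x - μ k
    s² k = proj₂ (proj₂ (root k))
    -- `z` is `x u - A u`, and `w` is its analogue with a square root of each factor `x - μ k`.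
    z = combination (λ k → c k * (x - μ k)) v
    w = combination (λ k → c k * s k) v

    Au+z≈xu : (λ r → 1# * (A · u) r + z r) ≈ᵥ (λ r → x * u r)
    Au+z≈xu r = begin-equality
      1# * (A · u) r + z r
        ≈⟨ +-congʳ (*-congˡ (trans (·-combination A c v r) (∑-cong λ k → *-congˡ (eig k r)))) ⟩
      1# * ∑ (λ k → c k * (μ k * v k r)) + z r
        ≈⟨ ∑-linear 1# _ _ ⟨
      ∑ (λ k → 1# * (c k * (μ k * v k r)) + c k * (x - μ k) * v k r)
        ≈⟨ (∑-cong λ k → trans (+-congʳ (*-identityˡ _))
             (solve 4 (λ c μ v x → c :* (μ :* v) :+ c :* (x :- μ) :* v := x :* (c :* v))
               refl (c k) (μ k) (v k r) x)) ⟩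
      ∑ (λ k → x * (c k * v k r))
        ≈⟨ *-distribˡ-∑ x _ ⟨
      x * u r ∎

    -- Self-adjointness of `A` gives `μ k (v k ∙ v l) = μ l (v k ∙ v l)`; the difference of the two
    -- squared roots is `μ l - μ k`.
    orthogonality : ∀ k l → (s k * s k - s l * s l) * (v k ∙ v l) ≈ 0#
    orthogonality k l = begin-equality
      (s k * s k - s l * s l) * (v k ∙ v l)
        ≈⟨ *-congʳ (+-cong (s² k) (-‿cong (s² l))) ⟩
      ((x - μ k) - (x - μ l)) * (v k ∙ v l)
        ≈⟨ solve 4 (λ x a b g → ((x :- a) :- (x :- b)) :* g := b :* g :- a :* g)
             refl x (μ k) (μ l) (v k ∙ v l) ⟩
      μ l * (v k ∙ v l) - μ k * (v k ∙ v l)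
        ≈⟨ +-congʳ (begin-equality
             μ l * (v k ∙ v l)          ≈⟨ *-congˡ (∙-comm (v k) (v l)) ⟩
             μ l * (v l ∙ v k)          ≈⟨ ∙-scaleˡ (μ l) (v l) (v k) ⟨
             (λ r → μ l * v l r) ∙ v k  ≈⟨ ∙-cong (λ r → sym (eig l r)) (λ _ → refl) ⟩
             (A · v l) ∙ v k            ≈⟨ ∙-comm (A · v l) (v k) ⟩
             v k ∙ (A · v l)            ≈⟨ ·-self-adjoint A-sym (v k) (v l) ⟩
             (A · v k) ∙ v l            ≈⟨ ∙-cong (eig k) (λ _ → refl) ⟩
             (λ r → μ k * v k r) ∙ v l  ≈⟨ ∙-scaleˡ (μ k) (v k) (v l) ⟩
             μ k * (v k ∙ v l)          ∎) ⟩
      μ k * (v k ∙ v l) - μ k * (v k ∙ v l)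
        ≈⟨ -‿inverseʳ _ ⟩
      0# ∎

    -- Next to `v k ∙ v l` the root `s k` may be traded for `s l`: by `square-difference` the
    -- product `(s k - s l) * (v k ∙ v l)` vanishes, with no decision whether `μ k` and `μ l` agree.
    exchange : ∀ k l → (c k * s k) * (c l * s l) * (v k ∙ v l) ≈ c k * (c l * (x - μ l)) * (v k ∙ v l)
    exchange k l = begin-equality
      (c k * s k) * (c l * s l) * (v k ∙ v l)
        ≈⟨ solve 5 (λ a b s t g → (a :* s) :* (b :* t) :* g
                               := (a :* b :* t) :* ((s :- t) :* g) :+ a :* (b :* (t :* t)) :* g)
             refl (c k) (c l) (s k) (s l) (v k ∙ v l) ⟩
      (c k * c l * s l) * ((s k - s l) * (v k ∙ v l)) + c k * (c l * (s l * s l)) * (v k ∙ v l)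
        ≈⟨ +-cong (*-congˡ (square-difference (proj₁ (proj₂ (root k))) (proj₁ (proj₂ (root l)))
                              (orthogonality k l)))
                  (*-congʳ (*-congˡ (*-congˡ (s² l)))) ⟩
      (c k * c l * s l) * 0# + c k * (c l * (x - μ l)) * (v k ∙ v l)
        ≈⟨ trans (+-congʳ (zeroʳ _)) (+-identityˡ _) ⟩
      c k * (c l * (x - μ l)) * (v k ∙ v l) ∎

    w∙w≈u∙z : w ∙ w ≈ u ∙ z
    w∙w≈u∙z = begin-equality
      w ∙ w
        ≈⟨ combination-∙-combination _ _ v ⟩
      ∑ (λ k → ∑ λ l → (c k * s k) * (c l * s l) * (v k ∙ v l))
        ≈⟨ (∑-cong λ k → ∑-cong λ l → exchange k l) ⟩
      ∑ (λ k → ∑ λ l → c k * (c l * (x - μ l)) * (v k ∙ v l))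
        ≈⟨ combination-∙-combination _ _ v ⟨
      u ∙ z ∎

  -- Orthonormalisation

  LinearlyIndependent : Vector (Vector Carrier n) m → Set
  LinearlyIndependent v = ∀ c → combination c v ≈ᵥ (λ _ → 0#) → ∀ k → c k ≈ 0#

  -- The coefficients are pushed forward along `ι`, with value zero off its image; evaluating the
  -- pushforward at `ι k` returns `c k` because `ι` is injective.
  LinearlyIndependent-select : ∀ {v : Vector (Vector Carrier n) m} (ι : Fin l → Fin m) →
    Injective _≡_ _≡_ ι → LinearlyIndependent v → LinearlyIndependent (v ∘ ι)
  LinearlyIndependent-select {v = v} ι inj independent c eq k = begin-equality
    c k                         ≈⟨ ∑-δ k c ⟨
    ∑ (λ j → δ k j * c j)
      ≈⟨ (∑-cong λ j → trans (*-comm _ _) (*-congˡ (reflexive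
           (≡.trans (δ-sym k j) (≡.sym (δ-injective ι inj j k)))))) ⟩
    ∑ (λ j → c j * δ (ι j) (ι k))
      ≈⟨ independent (λ i → ∑ λ j → c j * δ (ι j) i) extension≈0 (ι k) ⟩
    0#                          ∎
    where
    extension≈0 : combination (λ i → ∑ λ j → c j * δ (ι j) i) v ≈ᵥ (λ _ → 0#)
    extension≈0 r = begin-equality
      combination (λ i → ∑ λ j → c j * δ (ι j) i) v r
        ≈⟨ combination-combination c (λ j → δ (ι j)) v r ⟨
      ∑ (λ j → c j * ∑ λ i → δ (ι j) i * v i r)
        ≈⟨ (∑-cong λ j → *-congˡ (∑-δ (ι j) (λ i → v i r))) ⟩
      combination c (v ∘ ι) r
        ≈⟨ eq r ⟩
      0# ∎

  Orthonormal : Vector (Vector Carrier n) m → Set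
  Orthonormal u = ∀ k l → u k ∙ u l ≈ δ k l

  InSpan : Vector (Vector Carrier n) m → Vector Carrier n → Set
  InSpan v w = ∃[ c ] w ≈ᵥ combination c v

  combination-∷ : ∀ c₀ c (v : Vector (Vector Carrier n) (suc m)) →
    combination (c₀ ∷ c) v ≈ᵥ λ r → c₀ * v zero r + combination c (tail v) r
  combination-∷ c₀ c v r = ∑-∷ _

  -- Recursion on the tail, after which the head is made orthogonal to the family found so far and
  -- scaled. The double negation comes from the scaling, where `w ∙ w` is known to be nonzero but
  -- has no explicit inverse. Span coefficients are recorded so that a bound valid on the span of
  -- `v` reaches the new vectors.
  gram-schmidt : ∀ {v : Vector (Vector Carrier n) m} → LinearlyIndependent v →
                 ¬ ¬ (∃[ u ] Orthonormal {n} {m} u × (∀ k → InSpan v (u k)))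
  gram-schmidt {m = zero} _ none = none ((λ ()) , (λ ()) , (λ ()))
  gram-schmidt {n} {suc m} {v} independent none = gram-schmidt independent-tail step
    where
    independent-tail : LinearlyIndependent (tail v)
    independent-tail c eq k = independent (0# ∷ c) (λ r → begin-equality
      combination (0# ∷ c) v r                   ≈⟨ combination-∷ 0# c v r ⟩
      0# * v zero r + combination c (tail v) r   ≈⟨ +-cong (zeroˡ _) (eq r) ⟩
      0# + 0#                                    ≈⟨ +-identityˡ 0# ⟩
      0#                                         ∎) (suc k)

    step : ¬ (∃[ u ] Orthonormal {n} {m} u × (∀ k → InSpan (tail v) (u k)))
    step (u , orthonormal , inSpan) = invert w∙w≉0 normalise
      where
      a : Vector Carrier m
      a k = - (v zero ∙ u k)
      w : Vector Carrier n
      w r = 1# * v zero r + combination a u r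
      d : Vector Carrier (suc m)
      d = 1# ∷ λ l → ∑ λ k → a k * proj₁ (inSpan k) l

      w≈ : w ≈ᵥ combination d v
      w≈ r = begin-equality
        1# * v zero r + combination a u r
          ≈⟨ +-congˡ (∑-cong λ k → *-congˡ (proj₂ (inSpan k) r)) ⟩
        1# * v zero r + ∑ (λ k → a k * combination (proj₁ (inSpan k)) (tail v) r)
          ≈⟨ +-congˡ (combination-combination a (λ k → proj₁ (inSpan k)) (tail v) r) ⟩
        1# * v zero r + combination (tail d) (tail v) r
          ≈⟨ ∑-∷ _ ⟨
        combination d v r ∎

      -- The leading coefficient of `d` is `1#`, so `w` vanishing would contradict independence of
      -- `v`.
      w∙w≉0 : ¬ (w ∙ w ≈ 0#)
      w∙w≉0 eq = 1≉0 (independent d (λ r → trans (sym (w≈ r)) (∙-definite w eq r)) zero)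

      w∙u≈0 : ∀ k → w ∙ u k ≈ 0#
      w∙u≈0 k = begin-equality
        w ∙ u k
          ≈⟨ ∙-linearˡ 1# (v zero) (combination a u) (u k) ⟩
        1# * (v zero ∙ u k) + combination a u ∙ u k
          ≈⟨ +-cong (*-identityˡ _) (combination-∙ a u (u k)) ⟩
        v zero ∙ u k + ∑ (λ l → a l * (u l ∙ u k))
          ≈⟨ +-congˡ (∑-cong λ l → trans (*-congˡ (trans (orthonormal l k)
               (reflexive (δ-sym l k)))) (*-comm _ _)) ⟩
        v zero ∙ u k + ∑ (λ l → δ k l * a l)
          ≈⟨ +-congˡ (∑-δ k a) ⟩
        v zero ∙ u k + - (v zero ∙ u k)
          ≈⟨ -‿inverseʳ _ ⟩
        0# ∎

      normalise : ¬ (∃[ y ] (w ∙ w) * y ≈ 1#)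
      normalise (y , wwy≈1) = none (u′ , orthonormal′ , inSpan′)
        where
        0≤y : 0# ≤ y
        0≤y = begin
          0#                   ≤⟨ *-nonneg (∙-nonneg w) (square-nonneg y) ⟩
          (w ∙ w) * (y * y)    ≈⟨ *-assoc _ y y ⟨
          (w ∙ w) * y * y      ≈⟨ *-congʳ wwy≈1 ⟩
          1# * y               ≈⟨ *-identityˡ y ⟩
          y                    ∎
        -- As `y` is the inverse of `w ∙ w`, its root `t` is the inverse of the length of `w`.
        t = proj₁ (sqrt 0≤y)
        u′ : Vector (Vector Carrier n) (suc m)
        u′ = (λ r → t * w r) ∷ u

        cross : ∀ k → (λ r → t * w r) ∙ u k ≈ 0#
        cross k = trans (∙-scaleˡ t w (u k)) (trans (*-congˡ (w∙u≈0 k)) (zeroʳ t))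

        orthonormal′ : Orthonormal u′
        orthonormal′ zero zero = begin-equality
          (λ r → t * w r) ∙ (λ r → t * w r)
            ≈⟨ (∑-cong λ r → solve 2 (λ t w → (t :* w) :* (t :* w) := (t :* t) :* (w :* w)) refl t (w r)) ⟩
          ∑ (λ r → (t * t) * (w r * w r))
            ≈⟨ *-distribˡ-∑ (t * t) _ ⟨
          (t * t) * (w ∙ w)
            ≈⟨ trans (*-congʳ (proj₂ (proj₂ (sqrt 0≤y)))) (*-comm y _) ⟩
          (w ∙ w) * y
            ≈⟨ wwy≈1 ⟩
          1# ∎
        orthonormal′ zero    (suc l) = cross l
        orthonormal′ (suc k) zero    = trans (∙-comm (u k) _) (cross k)
        orthonormal′ (suc k) (suc l) = orthonormal k l

        inSpan′ : ∀ k → InSpan v (u′ k)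
        inSpan′ zero = (λ l → t * d l) , λ r → begin-equality
          t * w r                     ≈⟨ *-congˡ (w≈ r) ⟩
          t * combination d v r       ≈⟨ *-distribˡ-∑ t _ ⟩
          ∑ (λ l → t * (d l * v l r))  ≈⟨ (∑-cong λ l → sym (*-assoc t (d l) (v l r))) ⟩
          ∑ (λ l → t * d l * v l r)    ∎
        inSpan′ (suc k) = (0# ∷ c) , λ r → begin-equality
          u k r                                      ≈⟨ proj₂ (inSpan k) r ⟩
          combination c (tail v) r                   ≈⟨ +-identityˡ _ ⟨
          0# + combination c (tail v) r              ≈⟨ +-congʳ (zeroˡ (v zero r)) ⟨
          0# * v zero r + combination c (tail v) r   ≈⟨ combination-∷ 0# c v r ⟨
          combination (0# ∷ c) v r                   ∎
          where
          c = proj₁ (inSpan k)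

  -- Gram-Schmidt may destroy the eigenvector property but keeps every `u k` in the span of `v`,
  -- where `rayleigh` applies; the factor `u k ∙ u k` is then 1.
  orthonormal-rayleigh : ∀ {A : Matrix n} {μ} {v : Vector (Vector Carrier n) m} {x} → Symmetric A →
    LinearlyIndependent v → Eigenfamily A μ v → (∀ k → μ k ≤ x) →
    ¬ ¬ (∃[ u ] Orthonormal {n} {m} u × (∀ k → u k ∙ (A · u k) ≤ x))
  orthonormal-rayleigh {A = A} {v = v} {x = x} A-sym independent eig μ≤x none =
    gram-schmidt independent λ (u , orthonormal , inSpan) → none (u , orthonormal , λ k →
      let c , u≈ = inSpan k in begin
        u k ∙ (A · u k)
          ≈⟨ ∙-cong u≈ (λ r → ∙-cong (λ _ → refl) u≈) ⟩
        combination c v ∙ (A · combination c v)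
          ≤⟨ rayleigh A-sym eig μ≤x c ⟩
        x * (combination c v ∙ combination c v)
          ≈⟨ *-congˡ (∙-cong u≈ u≈) ⟨
        x * (u k ∙ u k)
          ≈⟨ *-congˡ (trans (orthonormal k k) (reflexive (δ-refl k))) ⟩
        x * 1#
          ≈⟨ *-identityʳ x ⟩
        x ∎)

  -- Projectors and the Frobenius product

  infix 7 ⟪_,_⟫

  -- The Frobenius product, that is, the trace of the transpose of `X` times `Y`.
  ⟪_,_⟫ : Matrix n → Matrix n → Carrier
  ⟪ X , Y ⟫ = ∑ λ r → X r ∙ Y r

  ⟪⟫-comm : ∀ (X Y : Matrix n) → ⟪ X , Y ⟫ ≈ ⟪ Y , X ⟫
  ⟪⟫-comm X Y = ∑-cong λ r → ∙-comm (X r) (Y r)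

  ⟪⟫-linearˡ : ∀ a b (X Y Z : Matrix n) →
    ⟪ (λ r c → a * X r c + b * Y r c) , Z ⟫ ≈ a * ⟪ X , Z ⟫ + b * ⟪ Y , Z ⟫
  ⟪⟫-linearˡ a b X Y Z = begin-equality
    ⟪ (λ r c → a * X r c + b * Y r c) , Z ⟫
      ≈⟨ (∑-cong λ r → trans (∙-linearˡ a (X r) _ (Z r)) (+-congˡ (∙-scaleˡ b (Y r) (Z r)))) ⟩
    ∑ (λ r → a * (X r ∙ Z r) + b * (Y r ∙ Z r))
      ≈⟨ ∑-linear a _ _ ⟩
    a * ⟪ X , Z ⟫ + ∑ (λ r → b * (Y r ∙ Z r))
      ≈⟨ +-congˡ (*-distribˡ-∑ b _) ⟨
    a * ⟪ X , Z ⟫ + b * ⟪ Y , Z ⟫ ∎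

  ⟪⟫-norm : ∀ a b (X Y : Matrix n) → let Z = λ r c → a * X r c + b * Y r c in
    ⟪ Z , Z ⟫ ≈ a * a * ⟪ X , X ⟫ + b * b * ⟪ Y , Y ⟫ + (a * b + a * b) * ⟪ X , Y ⟫
  ⟪⟫-norm a b X Y = begin-equality
    ⟪ Z , Z ⟫
      ≈⟨ ⟪⟫-linearˡ a b X Y Z ⟩
    a * ⟪ X , Z ⟫ + b * ⟪ Y , Z ⟫
      ≈⟨ +-cong (*-congˡ (trans (⟪⟫-comm X Z) (⟪⟫-linearˡ a b X Y X)))
                (*-congˡ (trans (⟪⟫-comm Y Z) (⟪⟫-linearˡ a b X Y Y))) ⟩
    a * (a * ⟪ X , X ⟫ + b * ⟪ Y , X ⟫) + b * (a * ⟪ X , Y ⟫ + b * ⟪ Y , Y ⟫)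
      ≈⟨ +-congʳ (*-congˡ (+-congˡ (*-congˡ (⟪⟫-comm Y X)))) ⟩
    a * (a * ⟪ X , X ⟫ + b * ⟪ X , Y ⟫) + b * (a * ⟪ X , Y ⟫ + b * ⟪ Y , Y ⟫)
      ≈⟨ solve 5 (λ a b p q r → a :* (a :* p :+ b :* q) :+ b :* (a :* q :+ b :* r)
                             := a :* a :* p :+ b :* b :* r :+ (a :* b :+ a :* b) :* q)
           refl a b ⟪ X , X ⟫ ⟪ X , Y ⟫ ⟪ Y , Y ⟫ ⟩
    a * a * ⟪ X , X ⟫ + b * b * ⟪ Y , Y ⟫ + (a * b + a * b) * ⟪ X , Y ⟫ ∎
    where
    Z : Matrix _
    Z r c = a * X r c + b * Y r c

  ⟪⟫-nonneg : ∀ (X : Matrix n) → 0# ≤ ⟪ X , X ⟫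
  ⟪⟫-nonneg X = ∑-nonneg λ r → ∙-nonneg (X r)

  -- Expanding the square of `b X + a Y` and cancelling `2 a b`, where `a` and `b` are upper bounds
  -- for the two norms. This one-sided form never forms the norms themselves.
  cauchy-schwarz : ∀ {X Y : Matrix n} {a b} → 0# ≤ a → 0# ≤ b → ¬ a * b ≈ 0# →
    ⟪ X , X ⟫ ≤ a * a → ⟪ Y , Y ⟫ ≤ b * b → 0# ≤ a * b + ⟪ X , Y ⟫
  cauchy-schwarz {X = X} {Y} {a} {b} 0≤a 0≤b ab≉0 XX≤aa YY≤bb =
    *-cancelˡ-≤ (≤-trans 0≤ab (x≤x+y (a * b) 0≤ab)) (ab≉0 ∘ proj₁ ∘ nonneg-+≈0 0≤ab 0≤ab) (begin
      (a * b + a * b) * 0#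
        ≈⟨ zeroʳ _ ⟩
      0#
        ≤⟨ ⟪⟫-nonneg (λ r c → b * X r c + a * Y r c) ⟩
      ⟪ (λ r c → b * X r c + a * Y r c) , (λ r c → b * X r c + a * Y r c) ⟫
        ≈⟨ ⟪⟫-norm b a X Y ⟩
      b * b * ⟪ X , X ⟫ + a * a * ⟪ Y , Y ⟫ + (b * a + b * a) * ⟪ X , Y ⟫
        ≤⟨ +-monoˡ-≤ _ (+-mono-≤ (*-monoˡ-≤ (square-nonneg b) XX≤aa)
                                 (*-monoˡ-≤ (square-nonneg a) YY≤bb)) ⟩
      b * b * (a * a) + a * a * (b * b) + (b * a + b * a) * ⟪ X , Y ⟫
        ≈⟨ solve 3 (λ a b q → b :* b :* (a :* a) :+ a :* a :* (b :* b) :+ (b :* a :+ b :* a) :* q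
                           := (a :* b :+ a :* b) :* (a :* b :+ q)) refl a b ⟪ X , Y ⟫ ⟩
      (a * b + a * b) * (a * b + ⟪ X , Y ⟫) ∎)
    where
    0≤ab = *-nonneg 0≤a 0≤b

  -- The natural number `n` in the field, as the sum of ones that traces and norms produce.
  count : ℕ → Carrier
  count n = ∑ {n} λ _ → 1#

  0≤1 : 0# ≤ 1#
  0≤1 = ≤-trans (square-nonneg 1#) (≤-reflexive (*-identityˡ 1#))

  0≤count : ∀ n → 0# ≤ count n
  0≤count n = ∑-nonneg λ _ → 0≤1

  ∑-const : ∀ n x → ∑ {n} (λ _ → x) ≈ count n * x
  ∑-const n x = begin-equality
    ∑ {n} (λ _ → x)        ≈⟨ (∑-cong λ _ → *-identityˡ x) ⟨
    ∑ {n} (λ _ → 1# * x)   ≈⟨ *-distribʳ-∑ x _ ⟨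
    count n * x            ∎

  entries≤1⇒norm : ∀ {X : Matrix n} → (∀ r c → X r c * X r c ≤ 1#) → ⟪ X , X ⟫ ≤ count n * count n
  entries≤1⇒norm {n} {X} X²≤1 = begin
    ⟪ X , X ⟫            ≤⟨ (∑-mono-≤ λ r → ∑-mono-≤ λ c → X²≤1 r c) ⟩
    ∑ {n} (λ _ → count n)  ≈⟨ ∑-const n (count n) ⟩
    count n * count n    ∎

  -- The sum of the rank-one matrices given by the outer squares of the `u k`; for orthonormal `u`,
  -- the orthogonal projector onto their span.
  projector : Vector (Vector Carrier n) m → Matrix n
  projector u r = combination (λ k → u k r) u

  ⟪⟫-projector : ∀ (X : Matrix n) (u : Vector (Vector Carrier n) m) →
                 ⟪ X , projector u ⟫ ≈ ∑ λ k → u k ∙ (X · u k)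
  ⟪⟫-projector X u = begin-equality
    ∑ (λ r → X r ∙ projector u r)
      ≈⟨ (∑-cong λ r → trans (∙-comm (X r) _) (combination-∙ (λ k → u k r) u (X r))) ⟩
    ∑ (λ r → ∑ λ k → u k r * (u k ∙ X r))
      ≈⟨ ∑-comm _ ⟩
    ∑ (λ k → ∑ λ r → u k r * (u k ∙ X r))
      ≈⟨ (∑-cong λ k → ∑-cong λ r → *-congˡ (∙-comm (u k) (X r))) ⟩
    ∑ (λ k → u k ∙ (X · u k)) ∎

  -- Writing the product as a sum of squared inner products shows that it is nonnegative, and
  -- reduces the norm of one projector to counting its orthonormal vectors.
  ⟪projector,projector⟫ : ∀ {l} (u : Vector (Vector Carrier n) m) (w : Vector (Vector Carrier n) l) →
    ⟪ projector u , projector w ⟫ ≈ ∑ λ k → ∑ λ j → (u j ∙ w k) * (u j ∙ w k)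
  ⟪projector,projector⟫ u w = trans (⟪⟫-projector (projector u) w) (∑-cong λ k → begin-equality
    w k ∙ (projector u · w k)
      ≈⟨ ∙-cong (λ _ → refl) (λ r → trans (combination-∙ (λ j → u j r) u (w k))
           (∑-cong λ j → *-comm (u j r) _)) ⟩
    w k ∙ combination (λ j → u j ∙ w k) u
      ≈⟨ ∙-comm (w k) _ ⟩
    combination (λ j → u j ∙ w k) u ∙ w k
      ≈⟨ combination-∙ _ u (w k) ⟩
    ∑ (λ j → (u j ∙ w k) * (u j ∙ w k)) ∎)

  projector-norm : ∀ {u : Vector (Vector Carrier n) m} → Orthonormal u →
                   ⟪ projector u , projector u ⟫ ≈ count m
  projector-norm {u = u} orthonormal = trans (⟪projector,projector⟫ u u) (∑-cong λ k → begin-equality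
    ∑ (λ j → (u j ∙ u k) * (u j ∙ u k))
      ≈⟨ (∑-cong λ j → *-cong (orthonormal j k) (orthonormal j k)) ⟩
    ∑ (λ j → δ j k * δ j k)
      ≈⟨ (∑-cong λ j → trans (δ-square j k) (trans (reflexive (δ-sym j k)) (sym (*-identityʳ _)))) ⟩
    ∑ (λ j → δ k j * 1#)
      ≈⟨ ∑-δ k (λ _ → 1#) ⟩
    1# ∎)

  -- Trace bounds by Cauchy-Schwarz

  ⟪⟫-projector-≤ : ∀ {X : Matrix n} {u : Vector (Vector Carrier n) m} {x} →
    (∀ k → u k ∙ (X · u k) ≤ x) → ⟪ X , projector u ⟫ ≤ count m * x
  ⟪⟫-projector-≤ {m = m} {X = X} {u} {x} uXu≤x = begin
    ⟪ X , projector u ⟫          ≈⟨ ⟪⟫-projector X u ⟩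
    ∑ (λ k → u k ∙ (X · u k))    ≤⟨ ∑-mono-≤ uXu≤x ⟩
    ∑ {m} (λ _ → x)              ≈⟨ ∑-const m x ⟩
    count m * x                  ∎

  -- With R the projector onto the span of `u`, of Frobenius norm `k`, Cauchy-Schwarz gives
  -- `0 ≤ n k + ⟪ X , R ⟫ ≤ n k + k² x`, and one factor `k` cancels. It is meant for `X = - A`.
  square-family-bound : ∀ {X : Matrix n} {u : Vector (Vector Carrier n) m} {x k} →
    (∀ r c → X r c * X r c ≤ 1#) → Orthonormal u → (∀ k → u k ∙ (X · u k) ≤ x) →
    0# ≤ k → count m ≈ k * k → ¬ count n * k ≈ 0# → 0# ≤ count n + k * x
  square-family-bound {n} {m} {X} {u} {x} {k} X²≤1 orthonormal uXu≤x 0≤k m≈kk nk≉0 =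
    *-cancelˡ-≤ 0≤k (λ k≈0 → nk≉0 (trans (*-congˡ k≈0) (zeroʳ _))) (begin
      k * 0#                              ≈⟨ zeroʳ k ⟩
      0#
        ≤⟨ cauchy-schwarz (0≤count n) 0≤k nk≉0 (entries≤1⇒norm X²≤1)
             (≤-reflexive (trans (projector-norm orthonormal) m≈kk)) ⟩
      count n * k + ⟪ X , projector u ⟫   ≤⟨ +-monoʳ-≤ _ (⟪⟫-projector-≤ uXu≤x) ⟩
      count n * k + count m * x           ≈⟨ +-congˡ (*-congʳ m≈kk) ⟩
      count n * k + k * k * x
        ≈⟨ solve 3 (λ n k x → n :* k :+ k :* k :* x := k :* (n :+ k :* x)) refl (count n) k x ⟩
      k * (count n + k * x)               ∎)

  -- The hypothesis on entries reads `X + J = 2 A + I`, and `u ∙ J u` is the square of `∑ u`. Adding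
  -- that square to `u ∙ (X · u)` therefore gives `2 u ∙ (A · u) + u ∙ u`.
  seidel-rayleigh : ∀ {X A : Matrix n} {u x} → (∀ r c → X r c + 1# ≈ A r c + A r c + δ r c) →
    u ∙ u ≈ 1# → u ∙ (A · u) ≤ x → u ∙ (X · u) ≤ x + x + 1#
  seidel-rayleigh {n} {X} {A} {u} {x} X+J≈ uu≈1 uAu≤x = begin
    u ∙ (X · u)
      ≤⟨ x≤x+y _ (square-nonneg (∑ u)) ⟩
    u ∙ (X · u) + ∑ u * ∑ u
      ≈⟨ +-congˡ (*-distribʳ-∑ (∑ u) u) ⟩
    u ∙ (X · u) + ∑ (λ r → u r * ∑ u)
      ≈⟨ ∑-+ _ _ ⟨
    ∑ (λ r → u r * (X r ∙ u) + u r * ∑ u)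
      ≈⟨ (∑-cong λ r → trans (sym (distribˡ (u r) _ _)) (*-congˡ (row r))) ⟩
    ∑ (λ r → u r * ((A · u) r + (A · u) r + u r))
      ≈⟨ (∑-cong λ r → trans (distribˡ (u r) _ _) (+-congʳ (distribˡ (u r) _ _))) ⟩
    ∑ (λ r → u r * (A · u) r + u r * (A · u) r + u r * u r)
      ≈⟨ trans (∑-+ _ _) (+-congʳ (∑-+ _ _)) ⟩
    u ∙ (A · u) + u ∙ (A · u) + u ∙ u
      ≤⟨ +-mono-≤ (+-mono-≤ uAu≤x uAu≤x) (≤-reflexive uu≈1) ⟩
    x + x + 1# ∎
    where
    row : ∀ r → X r ∙ u + ∑ u ≈ (A · u) r + (A · u) r + u r
    row r = begin-equality
      X r ∙ u + ∑ u
        ≈⟨ ∑-+ _ _ ⟨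
      ∑ (λ c → X r c * u c + u c)
        ≈⟨ (∑-cong λ c → begin-equality
             X r c * u c + u c               ≈⟨ +-congˡ (*-identityˡ (u c)) ⟨
             X r c * u c + 1# * u c          ≈⟨ distribʳ (u c) _ _ ⟨
             (X r c + 1#) * u c              ≈⟨ *-congʳ (X+J≈ r c) ⟩
             (A r c + A r c + δ r c) * u c   ≈⟨ trans (distribʳ (u c) _ _) (+-congʳ (distribʳ (u c) _ _)) ⟩
             A r c * u c + A r c * u c + δ r c * u c ∎) ⟩
      ∑ (λ c → A r c * u c + A r c * u c + δ r c * u c)
        ≈⟨ trans (∑-+ _ _) (+-cong (∑-+ _ _) (∑-δ r u)) ⟩
      (A · u) r + (A · u) r + u r ∎

  -- Cauchy–Schwarz for the Seidel matrix A - B against p P - q Q, where P and Q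
  -- are the projectors onto the spans of u and w.
  complementary-rayleigh : ∀ {A B : Matrix n} {u : Vector (Vector Carrier n) m}
    {w : Vector (Vector Carrier n) l} {x y p q s} →
    (∀ r c → A r c + B r c + δ r c ≈ 1#) → (∀ r c → (A r c - B r c) * (A r c - B r c) ≤ 1#) →
    Orthonormal u → (∀ k → u k ∙ (A · u k) ≤ x) →
    Orthonormal w → (∀ k → w k ∙ (B · w k) ≤ y) →
    0# ≤ p → p * count m ≈ 1# → 0# ≤ q → q * count l ≈ 1# →
    0# ≤ s → s * s ≈ p + q → ¬ count n * s ≈ 0# →
    0# ≤ count n * s + ((x + x + 1#) + (y + y + 1#))
  complementary-rayleigh {n} {m} {l} {A} {B} {u} {w} {x} {y} {p} {q} {s}
    A+B+I≈J S²≤1 orthonormal-u uAu≤x orthonormal-w wBw≤y 0≤p pm≈1 0≤q ql≈1 0≤s ss≈p+q ns≉0 = begin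
    0#
      ≤⟨ cauchy-schwarz (0≤count n) 0≤s ns≉0 (entries≤1⇒norm S²≤1) TT≤ss ⟩
    count n * s + ⟪ S , T ⟫
      ≤⟨ +-monoʳ-≤ _ ST≤ ⟩
    count n * s + ((x + x + 1#) + (y + y + 1#)) ∎
    where
    S S′ P Q T : Matrix n
    S r c = A r c - B r c
    -- `S′` is `- S`, in the form obtained by exchanging `A` and `B`, so that `seidel-rayleigh`
    -- serves both sides.
    S′ r c = B r c - A r c
    P = projector u
    Q = projector w
    T r c = p * P r c + (- q) * Q r c

    S+J≈ : ∀ r c → S r c + 1# ≈ A r c + A r c + δ r c
    S+J≈ r c = trans (+-congˡ (sym (A+B+I≈J r c)))
      (solve 3 (λ a b d → a :- b :+ (a :+ b :+ d) := a :+ a :+ d) refl (A r c) (B r c) (δ r c))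

    S′+J≈ : ∀ r c → S′ r c + 1# ≈ B r c + B r c + δ r c
    S′+J≈ r c = trans (+-congˡ (sym (A+B+I≈J r c)))
      (solve 3 (λ a b d → b :- a :+ (a :+ b :+ d) := b :+ b :+ d) refl (A r c) (B r c) (δ r c))

    weighted : ∀ {j} {X : Matrix n} {z : Vector (Vector Carrier n) j} {a b} →
               0# ≤ a → a * count j ≈ 1# → (∀ k → z k ∙ (X · z k) ≤ b) → a * ⟪ X , projector z ⟫ ≤ b
    weighted {j} {X} {z} {a} {b} 0≤a aj≈1 zXz≤b = begin
      a * ⟪ X , projector z ⟫   ≤⟨ *-monoˡ-≤ 0≤a (⟪⟫-projector-≤ zXz≤b) ⟩
      a * (count j * b)         ≈⟨ *-assoc a _ b ⟨
      a * count j * b           ≈⟨ *-congʳ aj≈1 ⟩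
      1# * b                    ≈⟨ *-identityˡ b ⟩
      b                         ∎

    unit : ∀ {j} {z : Vector (Vector Carrier n) j} → Orthonormal z → ∀ k → z k ∙ z k ≈ 1#
    unit orthonormal k = trans (orthonormal k k) (reflexive (δ-refl k))

    ⟪S,Q⟫≈ : (- q) * ⟪ S , Q ⟫ ≈ q * ⟪ S′ , Q ⟫
    ⟪S,Q⟫≈ = begin-equality
      (- q) * ⟪ S , Q ⟫
        ≈⟨ trans (*-distribˡ-∑ (- q) _) (∑-cong λ r → *-distribˡ-∑ (- q) _) ⟩
      ∑ (λ r → ∑ λ c → (- q) * (S r c * Q r c))
        ≈⟨ (∑-cong λ r → ∑-cong λ c → solve 4 (λ q a b z → (:- q) :* ((a :- b) :* z) := q :* ((b :- a) :* z))
             refl q (A r c) (B r c) (Q r c)) ⟩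
      ∑ (λ r → ∑ λ c → q * (S′ r c * Q r c))
        ≈⟨ trans (*-distribˡ-∑ q _) (∑-cong λ r → *-distribˡ-∑ q _) ⟨
      q * ⟪ S′ , Q ⟫ ∎

    ST≤ : ⟪ S , T ⟫ ≤ (x + x + 1#) + (y + y + 1#)
    ST≤ = begin
      ⟪ S , T ⟫
        ≈⟨ trans (⟪⟫-comm S T) (⟪⟫-linearˡ p (- q) P Q S) ⟩
      p * ⟪ P , S ⟫ + (- q) * ⟪ Q , S ⟫
        ≈⟨ +-cong (*-congˡ (⟪⟫-comm P S)) (trans (*-congˡ (⟪⟫-comm Q S)) ⟪S,Q⟫≈) ⟩
      p * ⟪ S , P ⟫ + q * ⟪ S′ , Q ⟫
        ≤⟨ +-mono-≤
             (weighted 0≤p pm≈1 λ k → seidel-rayleigh S+J≈ (unit orthonormal-u k) (uAu≤x k))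
             (weighted 0≤q ql≈1 λ k → seidel-rayleigh S′+J≈ (unit orthonormal-w k) (wBw≤y k)) ⟩
      (x + x + 1#) + (y + y + 1#) ∎

    -- Since `⟪ P , P ⟫ = m` and `p m = 1`, the term `p² ⟪ P , P ⟫` collapses to `p`, and likewise
    -- for `q`. Adding `2 p q ⟪ P , Q ⟫` cancels the negative cross term.
    TT≤ss : ⟪ T , T ⟫ ≤ s * s
    TT≤ss = begin
      ⟪ T , T ⟫
        ≤⟨ x≤x+y _ (*-nonneg (≤-trans 0≤pq (x≤x+y (p * q) 0≤pq)) 0≤⟪P,Q⟫) ⟩
      ⟪ T , T ⟫ + (p * q + p * q) * ⟪ P , Q ⟫
        ≈⟨ +-congʳ (⟪⟫-norm p (- q) P Q) ⟩
      p * p * ⟪ P , P ⟫ + (- q) * (- q) * ⟪ Q , Q ⟫ + (p * (- q) + p * (- q)) * ⟪ P , Q ⟫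
        + (p * q + p * q) * ⟪ P , Q ⟫
        ≈⟨ solve 5 (λ p q a b c → p :* p :* a :+ (:- q) :* (:- q) :* b :+ (p :* (:- q) :+ p :* (:- q)) :* c
                                    :+ (p :* q :+ p :* q) :* c
                               := p :* (p :* a) :+ q :* (q :* b))
             refl p q ⟪ P , P ⟫ ⟪ Q , Q ⟫ ⟪ P , Q ⟫ ⟩
      p * (p * ⟪ P , P ⟫) + q * (q * ⟪ Q , Q ⟫)
        ≈⟨ +-cong (*-congˡ (trans (*-congˡ (projector-norm orthonormal-u)) pm≈1))
                  (*-congˡ (trans (*-congˡ (projector-norm orthonormal-w)) ql≈1)) ⟩
      p * 1# + q * 1#
        ≈⟨ +-cong (*-identityʳ p) (*-identityʳ q) ⟩
      p + q
        ≈⟨ ss≈p+q ⟨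
      s * s ∎
      where
      0≤pq = *-nonneg 0≤p 0≤q
      0≤⟪P,Q⟫ : 0# ≤ ⟪ P , Q ⟫
      0≤⟪P,Q⟫ = ≤-trans (∑-nonneg λ k → ∑-nonneg λ j → square-nonneg (u j ∙ w k))
                        (≤-reflexive (sym (⟪projector,projector⟫ u w)))

  count-0 : count 0 ≈ 0#
  count-0 = ∑-[] _

  count-suc : ∀ n → count (suc n) ≈ 1# + count n
  count-suc n = ∑-∷ _

  -- Bounds on eigenvalues in terms of their position

  smallest-eigenvalues : ∀ {A B : Matrix n} {μ ν} {v w : Vector (Vector Carrier n) n} {x y p q s}
    (ι : Fin m → Fin n) (κ : Fin l → Fin n) → Injective _≡_ _≡_ ι → Injective _≡_ _≡_ κ →
    Symmetric A → Symmetric B →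
    (∀ r c → A r c + B r c + δ r c ≈ 1#) → (∀ r c → (A r c - B r c) * (A r c - B r c) ≤ 1#) →
    LinearlyIndependent v → Eigenfamily A μ v → (∀ k → μ (ι k) ≤ x) →
    LinearlyIndependent w → Eigenfamily B ν w → (∀ k → ν (κ k) ≤ y) →
    0# ≤ p → p * count m ≈ 1# → 0# ≤ q → q * count l ≈ 1# →
    0# ≤ s → s * s ≈ p + q → ¬ count n * s ≈ 0# →
    0# ≤ count n * s + ((x + x + 1#) + (y + y + 1#))
  -- Stability of the goal opens the two double-negated orthonormal families, one for each matrix.
  smallest-eigenvalues ι κ ι-inj κ-inj A-sym B-sym A+B+I≈J S²≤1
    v-indep v-eig μ≤x w-indep w-eig ν≤y 0≤p pm≈1 0≤q ql≈1 0≤s ss≈p+q ns≉0 = ≤-stable λ ¬goal →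
    orthonormal-rayleigh A-sym (LinearlyIndependent-select ι ι-inj v-indep) (v-eig ∘ ι) μ≤x
      λ (_ , u-orth , uAu≤x) →
    orthonormal-rayleigh B-sym (LinearlyIndependent-select κ κ-inj w-indep) (w-eig ∘ κ) ν≤y
      λ (_ , w-orth , wBw≤y) →
    ¬goal (complementary-rayleigh A+B+I≈J S²≤1 u-orth uAu≤x w-orth wBw≤y
             0≤p pm≈1 0≤q ql≈1 0≤s ss≈p+q ns≉0)

  -- Lower bounds on eigenvalues of `A` are upper bounds on those of `- A`, so the Rayleigh bound is
  -- used for `- A` with negated eigenvalues. The conclusion says `x ≤ n / k` without dividing.
  largest-eigenvalues : ∀ {A : Matrix n} {μ} {v : Vector (Vector Carrier n) n} {x k}
    (ι : Fin m → Fin n) → Injective _≡_ _≡_ ι → Symmetric A → (∀ r c → A r c * A r c ≤ 1#) →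
    LinearlyIndependent v → Eigenfamily A μ v → (∀ k → x ≤ μ (ι k)) →
    0# ≤ k → count m ≈ k * k → ¬ count n * k ≈ 0# → 0# ≤ count n + k * (- x)
  largest-eigenvalues {A = A} {μ} {v} {x} ι ι-inj A-sym A²≤1 v-indep v-eig x≤μ 0≤k m≈kk nk≉0 =
    ≤-stable λ ¬goal →
    orthonormal-rayleigh {A = λ r c → - A r c} {μ = -_ ∘ μ ∘ ι} (λ r c → -‿cong (A-sym r c))
      (LinearlyIndependent-select ι ι-inj v-indep) (eig ∘ ι) (neg-antimono-≤ ∘ x≤μ)
      λ (_ , u-orth , uAu≤x) →
    ¬goal (square-family-bound (λ r c → ≤-trans (≤-reflexive (neg-square (A r c))) (A²≤1 r c))
             u-orth uAu≤x 0≤k m≈kk nk≉0)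
    where
    neg-square : ∀ a → (- a) * (- a) ≈ a * a
    neg-square = solve 1 (λ a → (:- a) :* (:- a) := a :* a) refl
    neg-antimono-≤ : ∀ {a b} → a ≤ b → - b ≤ - a
    neg-antimono-≤ {a} {b} a≤b = 0≤y-x⇒x≤y (≤-trans (x≤y⇒0≤y-x a≤b)
      (≤-reflexive (solve 2 (λ a b → b :- a := (:- a) :- (:- b)) refl a b)))
    eig : Eigenfamily (λ r c → - A r c) (-_ ∘ μ) v
    eig k r = begin-equality
      ∑ (λ c → - A r c * v k c)
        ≈⟨ (∑-cong λ c → solve 2 (λ a v → (:- a) :* v := con (ℚ.- 1ℚ) :* (a :* v)) refl (A r c) (v k c)) ⟩
      ∑ (λ c → ⟦ ℚ.- 1ℚ ⟧ * (A r c * v k c))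
        ≈⟨ *-distribˡ-∑ _ _ ⟨
      ⟦ ℚ.- 1ℚ ⟧ * (A · v k) r
        ≈⟨ *-congˡ (v-eig k r) ⟩
      ⟦ ℚ.- 1ℚ ⟧ * (μ k * v k r)
        ≈⟨ solve 2 (λ μ v → con (ℚ.- 1ℚ) :* (μ :* v) := (:- μ) :* v) refl (μ k) (v k r) ⟩
      - μ k * v k r ∎

  -- Normalisation by the number of vertices

  0≤⟦½⟧ : 0# ≤ ⟦ ½ ⟧
  -- The morphism from ℚ is only a ring morphism, so the sign comes from writing ½ as a sum of two
  -- squares, ½² + ½².
  0≤⟦½⟧ = begin
    0#                               ≤⟨ square-nonneg ⟦ ½ ⟧ ⟩
    ⟦ ½ ⟧ * ⟦ ½ ⟧                    ≤⟨ x≤x+y _ (square-nonneg ⟦ ½ ⟧) ⟩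
    ⟦ ½ ⟧ * ⟦ ½ ⟧ + ⟦ ½ ⟧ * ⟦ ½ ⟧    ≈⟨ solve 0 (con ½ :* con ½ :+ con ½ :* con ½ := con ½) refl ⟩
    ⟦ ½ ⟧                            ∎

  -- Multiplication by `r / 2`, where `r` is `1 / n`. The two additive ones become the error term
  -- `r`, which vanishes in the limit.
  normalised-lower : ∀ {n r s x y} → 0# ≤ r → r * n ≈ 1# →
    0# ≤ n * s + ((x + x + 1#) + (y + y + 1#)) → - (r * (x + y)) ≤ ⟦ ½ ⟧ * s + r
  normalised-lower {n} {r} {s} {x} {y} 0≤r rn≈1 0≤ = 0≤y-x⇒x≤y (begin
    0#
      ≤⟨ *-nonneg (*-nonneg 0≤⟦½⟧ 0≤r) 0≤ ⟩
    ⟦ ½ ⟧ * r * (n * s + ((x + x + 1#) + (y + y + 1#)))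
      -- The unit is passed as a variable `o`, because `con 1ℚ` would denote `⟦ 1ℚ ⟧` instead of
      -- `1#`.
      ≈⟨ solve 6 (λ r n s x y o → con ½ :* r :* (n :* s :+ ((x :+ x :+ o) :+ (y :+ y :+ o)))
                               := con ½ :* (r :* n :* s) :+ r :* o :+ r :* (x :+ y))
           refl r n s x y 1# ⟩
    ⟦ ½ ⟧ * (r * n * s) + r * 1# + r * (x + y)
      ≈⟨ +-congʳ (+-cong (*-congˡ (trans (*-congʳ rn≈1) (*-identityˡ s))) (*-identityʳ r)) ⟩
    ⟦ ½ ⟧ * s + r + r * (x + y)
      ≈⟨ solve 2 (λ a b → a :+ b := a :- (:- b)) refl _ _ ⟩
    ⟦ ½ ⟧ * s + r - (- (r * (x + y))) ∎)

  -- The sum of the two hypotheses is multiplied by `h r`, where `h` is `1 / k` and `r` is `1 / n`;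
  -- each summand `n` contributes one `h`.
  normalised-upper : ∀ {n r k h x y} → 0# ≤ r → r * n ≈ 1# → 0# ≤ h → h * k ≈ 1# →
    0# ≤ n + k * (- x) → 0# ≤ n + k * (- y) → r * (x + y) ≤ h + h
  normalised-upper {n} {r} {k} {h} {x} {y} 0≤r rn≈1 0≤h hk≈1 0≤x 0≤y = 0≤y-x⇒x≤y (begin
    0#
      ≤⟨ *-nonneg (*-nonneg 0≤h 0≤r) (≤-trans (≤-reflexive (sym (+-identityˡ 0#))) (+-mono-≤ 0≤x 0≤y)) ⟩
    h * r * (n + k * (- x) + (n + k * (- y)))
      ≈⟨ solve 6 (λ h r n k x y → h :* r :* (n :+ k :* (:- x) :+ (n :+ k :* (:- y)))
                               := h :* (r :* n) :+ h :* (r :* n) :- h :* k :* (r :* (x :+ y)))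
           refl h r n k x y ⟩
    h * (r * n) + h * (r * n) - h * k * (r * (x + y))
      ≈⟨ +-cong (+-cong hrn≈h hrn≈h) (-‿cong (trans (*-congʳ hk≈1) (*-identityˡ _))) ⟩
    h + h - r * (x + y) ∎)
    where
    hrn≈h : h * (r * n) ≈ h
    hrn≈h = trans (*-congˡ rn≈1) (*-identityʳ h)

open import Defs
open +-*-Solver using (solve; con; _:=_; _:+_; _:*_; _:-_; :-_)

-- The Cauchy reals form a Euclidean field

Eventually : (ℕ → Set) → Set
Eventually P = ∃[ N ] ∀ n → N ℕ.≤ n → P n

eventually-always : ∀ {P : ℕ → Set} → (∀ n → P n) → Eventually P
eventually-always f = 0 , λ n _ → f n

eventually-zip : ∀ {P Q R : ℕ → Set} → (∀ n → P n → Q n → R n) →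
                 Eventually P → Eventually Q → Eventually R
eventually-zip f (M , p) (N , q) = M ℕ.⊔ N , λ n ≤n →
  f n (p n (ℕ.m⊔n≤o⇒m≤o M N ≤n)) (q n (ℕ.m⊔n≤o⇒n≤o M N ≤n))

eventually-map : ∀ {P Q : ℕ → Set} → (∀ n → P n → Q n) → Eventually P → Eventually Q
eventually-map f (N , p) = N , λ n ≤n → f n (p n ≤n)

0≤q-p : ∀ {p q} → p ℚ.≤ q → 0ℚ ℚ.≤ q ℚ.- p
0≤q-p {p} {q} p≤q = ≡.subst (ℚ._≤ q ℚ.- p) (ℚ.+-inverseʳ p) (ℚ.+-monoˡ-≤ (ℚ.- p) p≤q)

-- The ring solver proves equations only, so inequalities of rationals are split into a nonnegative
-- gap and a ring identity.
by-gap : ∀ {p q} d → 0ℚ ℚ.≤ d → p ℚ.+ d ≡ q → p ℚ.≤ q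
by-gap {p} d 0≤d eq = ≡.subst₂ ℚ._≤_ (ℚ.+-identityʳ p) eq (ℚ.+-monoʳ-≤ p 0≤d)

p≤p+ε : ∀ p {ε} → 0ℚ ℚ.< ε → p ℚ.≤ p ℚ.+ ε
p≤p+ε p {ε} 0<ε = by-gap ε (ℚ.<⇒≤ 0<ε) ≡.refl

p<p+ε : ∀ p {ε} → 0ℚ ℚ.< ε → p ℚ.< p ℚ.+ ε
p<p+ε p {ε} 0<ε = ≡.subst (ℚ._< p ℚ.+ ε) (ℚ.+-identityʳ p) (ℚ.+-monoʳ-< p 0<ε)

halve-≤ : ∀ {p} q ε → p ℚ.≤ q ℚ.+ ½ ℚ.* ε ℚ.+ ½ ℚ.* ε → p ℚ.≤ q ℚ.+ ε
halve-≤ {p} q ε = ≡.subst (p ℚ.≤_) (≡.trans (ℚ.+-assoc q _ _) (≡.cong (q ℚ.+_) (½+½ ε)))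

square-nonnegℚ : ∀ p → 0ℚ ℚ.≤ p ℚ.* p
square-nonnegℚ p = ≡.subst (0ℚ ℚ.≤_) (∣p∣²≡p² (ℚ.∣p∣≡p∨∣p∣≡-p p))
  (≡.subst (ℚ._≤ ℚ.∣ p ∣ ℚ.* ℚ.∣ p ∣) (ℚ.*-zeroˡ 0ℚ)
    (*-mono-≤ (ℚ.0≤∣p∣ p) ℚ.≤-refl (ℚ.0≤∣p∣ p) (ℚ.0≤∣p∣ p)))
  where
  ∣p∣²≡p² : ℚ.∣ p ∣ ≡ p ⊎ ℚ.∣ p ∣ ≡ ℚ.- p → ℚ.∣ p ∣ ℚ.* ℚ.∣ p ∣ ≡ p ℚ.* p
  ∣p∣²≡p² (inj₁ eq) = ≡.cong₂ ℚ._*_ eq eq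
  ∣p∣²≡p² (inj₂ eq) = ≡.trans (≡.cong₂ ℚ._*_ eq eq)
    (solve 1 (λ p → (:- p) :* (:- p) := p :* p) ≡.refl p)

pointwise-≤ : ∀ x y → (∀ n → seq x n ℚ.≤ seq y n) → x ≤ y
pointwise-≤ x y x≤y ε 0<ε = eventually-always λ n → ℚ.≤-trans (x≤y n) (p≤p+ε (seq y n) 0<ε)

≤-trans : ∀ x y z → x ≤ y → y ≤ z → x ≤ z
≤-trans x y z x≤y y≤z ε 0<ε =
  eventually-zip (λ n p q → halve-≤ (seq z n) ε (ℚ.≤-trans p (ℚ.+-monoˡ-≤ (½ ℚ.* ε) q)))
    (x≤y _ (0<½* 0<ε)) (y≤z _ (0<½* 0<ε))

≤-antisym : ∀ x y → x ≤ y → y ≤ x → x ≈ y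
≤-antisym x y x≤y y≤x ε 0<ε =
  eventually-zip (λ n p q → ∣-∣-< (strict (seq y n) p) (strict (seq x n) q))
    (x≤y _ (0<½* 0<ε)) (y≤x _ (0<½* 0<ε))
  where
  strict : ∀ {p} q → p ℚ.≤ q ℚ.+ ½ ℚ.* ε → p ℚ.< q ℚ.+ ε
  strict {p} q p≤ = ℚ.≤-<-trans p≤ (≡.subst (q ℚ.+ ½ ℚ.* ε ℚ.<_)
    (≡.trans (ℚ.+-assoc q _ _) (≡.cong (q ℚ.+_) (½+½ ε))) (p<p+ε _ (0<½* 0<ε)))

≈⇒≤ : ∀ x y → x ≈ y → x ≤ y
≈⇒≤ x y x≈y ε 0<ε = eventually-map (λ n d → ℚ.<⇒≤ (∣-∣-<⇒< {seq x n} {seq y n} d)) (x≈y ε 0<ε)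

≈-sym : ∀ x y → x ≈ y → y ≈ x
≈-sym x y x≈y ε 0<ε = eventually-map (λ n → ≡.subst (ℚ._< ε)
  (≡.trans (≡.sym (ℚ.∣-p∣≡∣p∣ (seq x n ℚ.- seq y n)))
           (≡.cong ℚ.∣_∣ (swap- (seq x n) (seq y n))))) (x≈y ε 0<ε)

pointwise-≈ : ∀ x y → (∀ n → seq x n ≡ seq y n) → x ≈ y
pointwise-≈ x y x≡y = ≤-antisym x y
  (pointwise-≤ x y (ℚ.≤-reflexive ∘ x≡y)) (pointwise-≤ y x (ℚ.≤-reflexive ∘ ≡.sym ∘ x≡y))

≈-trans : ∀ x y z → x ≈ y → y ≈ z → x ≈ z
≈-trans x y z x≈y y≈z = ≤-antisym x z
  (≤-trans x y z (≈⇒≤ x y x≈y) (≈⇒≤ y z y≈z))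
  (≤-trans z y x (≈⇒≤ z y (≈-sym y z y≈z)) (≈⇒≤ y x (≈-sym x y x≈y)))

+-mono-≤ : ∀ w x y z → w ≤ x → y ≤ z → w + y ≤ x + z
+-mono-≤ w x y z w≤x y≤z ε 0<ε =
  eventually-zip (λ n p q → ≡.subst (seq w n ℚ.+ seq y n ℚ.≤_)
      (≡.trans (solve 3 (λ x z e → (x :+ e) :+ (z :+ e) := (x :+ z) :+ (e :+ e))
                 ≡.refl (seq x n) (seq z n) (½ ℚ.* ε))
               (≡.cong (seq x n ℚ.+ seq z n ℚ.+_) (½+½ ε)))
      (ℚ.+-mono-≤ p q))
    (w≤x _ (0<½* 0<ε)) (y≤z _ (0<½* 0<ε))

neg-antimono-≤ : ∀ x y → x ≤ y → - y ≤ - x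
neg-antimono-≤ x y x≤y ε 0<ε = eventually-map (λ n p → by-gap _ (0≤q-p p)
  (solve 3 (λ x y e → :- y :+ (y :+ e :- x) := :- x :+ e)
    ≡.refl (seq x n) (seq y n) ε)) (x≤y ε 0<ε)

+-cong : ∀ w x y z → w ≈ x → y ≈ z → w + y ≈ x + z
+-cong w x y z w≈x y≈z = ≤-antisym (w + y) (x + z)
  (+-mono-≤ w x y z (≈⇒≤ w x w≈x) (≈⇒≤ y z y≈z))
  (+-mono-≤ x w z y (≈⇒≤ x w (≈-sym w x w≈x)) (≈⇒≤ z y (≈-sym y z y≈z)))

-‿cong : ∀ x y → x ≈ y → - x ≈ - y
-‿cong x y x≈y = ≤-antisym (- x) (- y)
  (neg-antimono-≤ y x (≈⇒≤ y x (≈-sym x y x≈y))) (neg-antimono-≤ x y (≈⇒≤ x y x≈y))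

*-cong : ∀ x y z w → x ≈ y → z ≈ w → x * z ≈ y * w
*-cong x y z w x≈y z≈w ε 0<ε = go (bounded y) (bounded z)
  where
  go : EventuallyBounded (seq y) → EventuallyBounded (seq z) →
       Eventually λ n → ℚ.∣ seq x n ℚ.* seq z n ℚ.- seq y n ℚ.* seq w n ∣ ℚ.< ε
  go (B , 0<B , y<B) (C , 0<C , z<C)
    with δ , 0<δ , δB ← shrink B (½ ℚ.* ε) 0<B (0<½* 0<ε)
       | η , 0<η , ηC ← shrink C (½ ℚ.* ε) 0<C (0<½* 0<ε) =
    eventually-zip (λ n (yB , zC) (xy , zw) →
        *-close {seq x n} {seq y n} {seq z n} {seq w n} ε xy zC zw yB 0<B 0<C δB ηC)
      (eventually-zip (λ _ → _,_) y<B z<C) (eventually-zip (λ _ → _,_) (x≈y η 0<η) (z≈w δ 0<δ))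

ℝ-commutativeRing : CommutativeRing _ _
ℝ-commutativeRing = record
  { Carrier = ℝ ; _≈_ = _≈_ ; _+_ = _+_ ; _*_ = _*_ ; -_ = -_ ; 0# = 0ℝ ; 1# = 1ℝ
  ; isCommutativeRing = record
    { isRing = record
      { +-isAbelianGroup = record
        { isGroup = record
          { isMonoid = record
            { isSemigroup = record
              { isMagma = record
                { isEquivalence = record
                  { refl  = λ {x} → pointwise-≈ x x λ _ → ≡.refl
                  ; sym   = λ {x} {y} → ≈-sym x y
                  ; trans = λ {x} {y} {z} → ≈-trans x y z }
                ; ∙-cong = λ {w} {x} {y} {z} → +-cong w x y z }
              ; assoc = λ x y z → pointwise-≈ (x + y + z) (x + (y + z))
                  λ n → ℚ.+-assoc (seq x n) (seq y n) (seq z n) }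
            ; identity = (λ x → pointwise-≈ (0ℝ + x) x (ℚ.+-identityˡ ∘ seq x)) ,
                          λ x → pointwise-≈ (x + 0ℝ) x (ℚ.+-identityʳ ∘ seq x) }
          ; inverse = (λ x → pointwise-≈ (- x + x) 0ℝ (ℚ.+-inverseˡ ∘ seq x)) ,
                       λ x → pointwise-≈ (x + - x) 0ℝ (ℚ.+-inverseʳ ∘ seq x)
          ; ⁻¹-cong = λ {x} {y} → -‿cong x y }
        ; comm = λ x y → pointwise-≈ (x + y) (y + x) λ n → ℚ.+-comm (seq x n) (seq y n) }
      ; *-cong = λ {x} {y} {z} {w} → *-cong x y z w
      ; *-assoc = λ x y z → pointwise-≈ (x * y * z) (x * (y * z))
          λ n → ℚ.*-assoc (seq x n) (seq y n) (seq z n)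
      ; *-identity = (λ x → pointwise-≈ (1ℝ * x) x (ℚ.*-identityˡ ∘ seq x)) ,
                      λ x → pointwise-≈ (x * 1ℝ) x (ℚ.*-identityʳ ∘ seq x)
      ; distrib = (λ x y z → pointwise-≈ (x * (y + z)) (x * y + x * z)
                     λ n → ℚ.*-distribˡ-+ (seq x n) (seq y n) (seq z n)) ,
                   λ x y z → pointwise-≈ ((y + z) * x) (y * x + z * x)
                     λ n → ℚ.*-distribʳ-+ (seq x n) (seq y n) (seq z n) }
    ; *-comm = λ x y → pointwise-≈ (x * y) (y * x) λ n → ℚ.*-comm (seq x n) (seq y n) } }

-- Compare x and y at one index past both Cauchy moduli.
≤-stable : ∀ x y → ¬ ¬ (x ≤ y) → x ≤ y
≤-stable x y ¬x≰y ε 0<ε = go (cauchy x η 0<η) (cauchy y η 0<η)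
  where
  -- Here `4 θ = ε` and `2 η = θ`. If `x ≤ y + 2 θ` at index K, moving both sequences costs `2 η`,
  -- for a total of `3 θ ≤ ε`. Otherwise `x ≤ y` is refuted, since with tolerance `η` it would give
  -- `x ≤ y + 3 η` at K, and `3 η ≤ 2 θ`.
  θ = ½ ℚ.* (½ ℚ.* ε)
  η = ½ ℚ.* θ
  0<θ = 0<½* (0<½* 0<ε)
  0<η = 0<½* 0<θ
  go : (∃[ M ] ∀ m n → M ℕ.≤ m → M ℕ.≤ n → ℚ.∣ seq x m ℚ.- seq x n ∣ ℚ.< η) →
       (∃[ N ] ∀ m n → N ℕ.≤ m → N ℕ.≤ n → ℚ.∣ seq y m ℚ.- seq y n ∣ ℚ.< η) →
       Eventually λ n → seq x n ℚ.≤ seq y n ℚ.+ ε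
  go (M , f) (N , g) with seq x (M ℕ.⊔ N) ℚ.≤? seq y (M ℕ.⊔ N) ℚ.+ (θ ℚ.+ θ)
  ... | yes xK≤ = K , λ n K≤n → by-gap _
        (ℚ.+-mono-≤ (ℚ.+-mono-≤ (ℚ.+-mono-≤ (0≤q-p xK≤) (0≤q-p (x-near n K K≤n ℕ.≤-refl)))
                                (0≤q-p (y-near K n ℕ.≤-refl K≤n))) (ℚ.<⇒≤ 0<θ))
        (solve 5 (λ x xK y yK e → let ½e = con ½ :* (con ½ :* e) in
             x :+ ((((yK :+ (½e :+ ½e)) :- xK)
               :+ ((xK :+ con ½ :* ½e) :- x)
               :+ ((y :+ con ½ :* ½e) :- yK)) :+ ½e)
             := y :+ e) ≡.refl (seq x n) (seq x K) (seq y n) (seq y K) ε)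
    where
    K = M ℕ.⊔ N
    x-near : ∀ m n → K ℕ.≤ m → K ℕ.≤ n → seq x m ℚ.≤ seq x n ℚ.+ η
    x-near m n p q = ℚ.<⇒≤ (∣-∣-<⇒< {seq x m} {seq x n} (f m n (ℕ.m⊔n≤o⇒m≤o M N p) (ℕ.m⊔n≤o⇒m≤o M N q)))
    y-near : ∀ m n → K ℕ.≤ m → K ℕ.≤ n → seq y m ℚ.≤ seq y n ℚ.+ η
    y-near m n p q = ℚ.<⇒≤ (∣-∣-<⇒< {seq y m} {seq y n} (g m n (ℕ.m⊔n≤o⇒n≤o M N p) (ℕ.m⊔n≤o⇒n≤o M N q)))
  ... | no xK≰ = contradiction (λ x≤y → refute (x≤y η 0<η)) ¬x≰y
    where
    K = M ℕ.⊔ N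
    refute : ¬ (Eventually λ n → seq x n ℚ.≤ seq y n ℚ.+ η)
    refute (L , x≤y) = xK≰ (by-gap _
      (ℚ.+-mono-≤ (ℚ.+-mono-≤ (ℚ.+-mono-≤ (0≤q-p xK≤xn) (0≤q-p (x≤y n (ℕ.m≤n⊔m K L)))) (0≤q-p yn≤yK))
        (ℚ.<⇒≤ 0<η))
      (solve 5 (λ x xK y yK e → 
             xK :+ ((((x :+ con ½ :* e) :- xK)
               :+ ((y :+ con ½ :* e) :- x)
               :+ ((yK :+ con ½ :* e) :- y)) :+ con ½ :* e)
             := yK :+ (e :+ e)) ≡.refl (seq x n) (seq x K) (seq y n) (seq y K) θ))
      where
      n = K ℕ.⊔ L
      K≤n = ℕ.m≤m⊔n K L
      xK≤xn : seq x K ℚ.≤ seq x n ℚ.+ η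
      xK≤xn = ℚ.<⇒≤ (∣-∣-<⇒< {seq x K} {seq x n} (f K n (ℕ.m≤m⊔n M N) (ℕ.≤-trans (ℕ.m≤m⊔n M N) K≤n)))
      yn≤yK : seq y n ℚ.≤ seq y K ℚ.+ η
      yn≤yK = ℚ.<⇒≤ (∣-∣-<⇒< {seq y n} {seq y K} (g n K (ℕ.≤-trans (ℕ.m≤n⊔m M N) K≤n) (ℕ.m≤n⊔m M N)))

-- A nonnegative real may have negative terms; its absolute value is an equal real whose terms are
-- nonnegative, so products can be compared termwise.
nonneg⇒≈∣∣ : ∀ x → 0ℝ ≤ x → x ≈ ∣ x ∣
nonneg⇒≈∣∣ x 0≤x = ≤-antisym x ∣ x ∣ (pointwise-≤ x ∣ x ∣ (p≤∣p∣ ∘ seq x)) λ ε 0<ε →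
  eventually-map (λ n 0≤ → abs ε (seq x n) 0<ε 0≤ (ℚ.∣p∣≡p∨∣p∣≡-p (seq x n))) (0≤x _ (0<½* 0<ε))
  where
  abs : ∀ ε p → 0ℚ ℚ.< ε → 0ℚ ℚ.≤ p ℚ.+ ½ ℚ.* ε →
        ℚ.∣ p ∣ ≡ p ⊎ ℚ.∣ p ∣ ≡ ℚ.- p → ℚ.∣ p ∣ ℚ.≤ p ℚ.+ ε
  abs ε p 0<ε 0≤ (inj₁ eq) = ≡.subst (ℚ._≤ p ℚ.+ ε) (≡.sym eq) (p≤p+ε p 0<ε)
  abs ε p 0<ε 0≤ (inj₂ eq) = ≡.subst (ℚ._≤ p ℚ.+ ε) (≡.sym eq) (by-gap _ (ℚ.+-mono-≤ 0≤ 0≤)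
    (solve 2 (λ p e → :- p :+ (p :+ con ½ :* e :+ (p :+ con ½ :* e))
       := p :+ e) ≡.refl p ε))

*-nonneg : ∀ x y → 0ℝ ≤ x → 0ℝ ≤ y → 0ℝ ≤ x * y
*-nonneg x y 0≤x 0≤y = ≤-trans 0ℝ (∣ x ∣ * ∣ y ∣) (x * y)
  (pointwise-≤ 0ℝ (∣ x ∣ * ∣ y ∣) λ n → ≡.subst (0ℚ ℚ.≤_) (ℚ.∣p*q∣≡∣p∣*∣q∣ (seq x n) (seq y n))
    (ℚ.0≤∣p∣ (seq x n ℚ.* seq y n)))
  (≈⇒≤ (∣ x ∣ * ∣ y ∣) (x * y) (≈-sym (x * y) (∣ x ∣ * ∣ y ∣)
    (*-cong x (∣ x ∣) y (∣ y ∣) (nonneg⇒≈∣∣ x 0≤x) (nonneg⇒≈∣∣ y 0≤y))))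

meshℝ : ℝ
meshℝ = mkℝ mesh λ ε 0<ε → let N , small = mesh-small ε 0<ε in
  N , λ m n N≤m N≤n → ∣-∣-< (near ε m n (small m N≤m)) (near ε n m (small n N≤n))
  where
  near : ∀ ε m n → mesh m ℚ.< ε → mesh m ℚ.< mesh n ℚ.+ ε
  near ε m n m<ε = ≡.subst (ℚ._< mesh n ℚ.+ ε) (ℚ.+-identityˡ (mesh m)) (ℚ.+-mono-< (mesh>0 n) m<ε)

meshℝ≈0 : meshℝ ≈ 0ℝ
meshℝ≈0 = ≤-antisym meshℝ 0ℝ
  (λ ε 0<ε → let N , small = mesh-small ε 0<ε in N , λ n N≤n →
     ≡.subst (mesh n ℚ.≤_) (≡.sym (ℚ.+-identityˡ ε)) (ℚ.<⇒≤ (small n N≤n)))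
  (pointwise-≤ 0ℝ meshℝ (ℚ.<⇒≤ ∘ mesh>0))

0≤√ : ∀ x → 0ℝ ≤ √ x
0≤√ x = pointwise-≤ 0ℝ (√ x) λ n → approx√-nonneg (seq x n ℚ.⊔ 0ℚ) n

-- √ x + meshℝ is equal to √ x and its square bounds x termwise.
√-square : ∀ x → 0ℝ ≤ x → (√ x) * (√ x) ≈ x
√-square x 0≤x = ≤-antisym ((√ x) * (√ x)) x
  (λ ε 0<ε → eventually-map (λ n 0≤ → ℚ.≤-trans (approx√-lower (seq x n ℚ.⊔ 0ℚ) n (ℚ.p≤q⊔p (seq x n) 0ℚ))
                             (ℚ.⊔-lub (p≤p+ε (seq x n) 0<ε) 0≤)) (0≤x ε 0<ε))
  (≤-trans x (r * r) ((√ x) * (√ x))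
    (pointwise-≤ x (r * r) λ n → ℚ.≤-trans (ℚ.p≤p⊔q (seq x n) 0ℚ) (ℚ.<⇒≤ (approx√-upper (seq x n ℚ.⊔ 0ℚ) n)))
    (≈⇒≤ (r * r) ((√ x) * (√ x)) (*-cong r (√ x) r (√ x) r≈√ r≈√)))
  where
  r = (√ x) + meshℝ
  r≈√ : r ≈ √ x
  r≈√ = ≈-trans r ((√ x) + 0ℝ) (√ x)
    (+-cong (√ x) (√ x) meshℝ 0ℝ (pointwise-≈ (√ x) (√ x) λ _ → ≡.refl) meshℝ≈0)
    (pointwise-≈ ((√ x) + 0ℝ) (√ x) (ℚ.+-identityʳ ∘ seq (√ x)))

-- Inverses of reals

inverseℚ : ℚ → ℚ
inverseℚ p with p ℚ.≟ 0ℚ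
-- A default value: finitely many terms of an invertible real may be zero.
... | yes _  = 0ℚ
... | no p≢0 = ℚ.1/_ p {{ℚ.≢-nonZero p≢0}}

inverseℚ-inverse : ∀ p {θ} → 0ℚ ℚ.< θ → θ ℚ.≤ ℚ.∣ p ∣ → p ℚ.* inverseℚ p ≡ 1ℚ
inverseℚ-inverse p 0<θ θ≤∣p∣ with p ℚ.≟ 0ℚ
... | yes ≡.refl = contradiction (ℚ.<-≤-trans 0<θ θ≤∣p∣) (ℚ.<-irrefl ≡.refl)
... | no  p≢0    = ℚ.*-inverseʳ p {{ℚ.≢-nonZero p≢0}}

-- From `N` on the reciprocals are bounded by `K = 1 / θ`. Since `1/a - 1/b = (b - a) / (a b)`, the
-- modulus of `x` at `ε / K²` is a modulus for the reciprocal.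
apart⇒invertible : ∀ x θ → 0ℚ ℚ.< θ → (Eventually λ n → θ ℚ.≤ ℚ.∣ seq x n ∣) → ∃[ y ] x * y ≈ 1ℝ
apart⇒invertible x θ 0<θ (N , apart) = y , ≤-antisym (x * y) 1ℝ
    (λ ε 0<ε → N , λ n N≤n → ≡.subst (ℚ._≤ 1ℚ ℚ.+ ε) (≡.sym (xy≡1 n N≤n)) (p≤p+ε 1ℚ 0<ε))
    (λ ε 0<ε → N , λ n N≤n → ≡.subst (λ t → 1ℚ ℚ.≤ t ℚ.+ ε) (≡.sym (xy≡1 n N≤n)) (p≤p+ε 1ℚ 0<ε))
  where
  x⁻¹ : ℕ → ℚ
  x⁻¹ n = inverseℚ (seq x n)
  xy≡1 : ∀ n → N ℕ.≤ n → seq x n ℚ.* x⁻¹ n ≡ 1ℚ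
  xy≡1 n N≤n = inverseℚ-inverse (seq x n) 0<θ (apart n N≤n)
  K = proj₁ (shrink θ 1ℚ 0<θ (ℚ.positive⁻¹ 1ℚ))
  0<K = proj₁ (proj₂ (shrink θ 1ℚ 0<θ (ℚ.positive⁻¹ 1ℚ)))
  Kθ≡1 = proj₂ (proj₂ (shrink θ 1ℚ 0<θ (ℚ.positive⁻¹ 1ℚ)))
  bound : ∀ n → N ℕ.≤ n → ℚ.∣ x⁻¹ n ∣ ℚ.≤ K
  bound n N≤n = ℚ.*-cancelʳ-≤-pos θ {{ℚ.positive 0<θ}} (≡.subst (ℚ.∣ x⁻¹ n ∣ ℚ.* θ ℚ.≤_) (≡.sym Kθ≡1)
    (≡.subst (ℚ.∣ x⁻¹ n ∣ ℚ.* θ ℚ.≤_)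
      (≡.trans (≡.sym (ℚ.∣p*q∣≡∣p∣*∣q∣ (x⁻¹ n) (seq x n)))
               (≡.cong ℚ.∣_∣ (≡.trans (ℚ.*-comm (x⁻¹ n) (seq x n)) (xy≡1 n N≤n))))
      (ℚ.*-monoˡ-≤-nonNeg ℚ.∣ x⁻¹ n ∣ {{ℚ.nonNegative (ℚ.0≤∣p∣ (x⁻¹ n))}} (apart n N≤n))))

  difference : ∀ a b {a′ b′} → a ℚ.* a′ ≡ 1ℚ → b ℚ.* b′ ≡ 1ℚ → a′ ℚ.- b′ ≡ (b ℚ.- a) ℚ.* (a′ ℚ.* b′)
  difference a b {a′} {b′} aa′≡1 bb′≡1 = ≡.sym (≡.trans
    (solve 4 (λ a b c d → (b :- a) :* (c :* d) := (b :* d) :* c :- (a :* c) :* d)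
      ≡.refl a b a′ b′)
    (≡.cong₂ ℚ._-_ (≡.trans (≡.cong (ℚ._* a′) bb′≡1) (ℚ.*-identityˡ a′))
                   (≡.trans (≡.cong (ℚ._* b′) aa′≡1) (ℚ.*-identityˡ b′))))

  y : ℝ
  y = mkℝ x⁻¹ λ ε 0<ε →
    let η , 0<η , ηKK≡ε = shrink (K ℚ.* K) ε (0<* 0<K 0<K) 0<ε
        M , f = cauchy x η 0<η
    in M ℕ.⊔ N , λ m n p q → ≡.subst₂ ℚ._<_
      (≡.trans (≡.sym (ℚ.∣p*q∣≡∣p∣*∣q∣ (seq x n ℚ.- seq x m) (x⁻¹ m ℚ.* x⁻¹ n)))
        (≡.sym (≡.cong ℚ.∣_∣ (difference (seq x m) (seq x n)
          (xy≡1 m (ℕ.m⊔n≤o⇒n≤o M N p)) (xy≡1 n (ℕ.m⊔n≤o⇒n≤o M N q))))))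
      ηKK≡ε
      (ℚ.≤-<-trans
        (ℚ.*-monoˡ-≤-nonNeg ℚ.∣ seq x n ℚ.- seq x m ∣ {{ℚ.nonNegative (ℚ.0≤∣p∣ (seq x n ℚ.- seq x m))}}
          (≡.subst (ℚ._≤ K ℚ.* K) (≡.sym (ℚ.∣p*q∣≡∣p∣*∣q∣ (x⁻¹ m) (x⁻¹ n)))
            (*-mono-≤ (ℚ.<⇒≤ 0<K) (ℚ.0≤∣p∣ (x⁻¹ n))
              (bound m (ℕ.m⊔n≤o⇒n≤o M N p)) (bound n (ℕ.m⊔n≤o⇒n≤o M N q)))))
        (ℚ.*-monoˡ-<-pos (K ℚ.* K) {{ℚ.positive (0<* 0<K 0<K)}}
          (f n m (ℕ.m⊔n≤o⇒m≤o M N q) (ℕ.m⊔n≤o⇒m≤o M N p))))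

-- For each `ε` one rational comparison of a late term with `ε / 2` decides: either all later terms
-- are below `ε`, or they stay at least `ε / 4` from zero and `x` is invertible. If no inverse
-- exists, the first case always holds and `x ≈ 0ℝ`.
invert : ∀ x → ¬ x ≈ 0ℝ → ¬ ¬ (∃[ y ] x * y ≈ 1ℝ)
invert x x≉0 none = x≉0 λ ε 0<ε → go ε 0<ε (cauchy x (½ ℚ.* (½ ℚ.* ε)) (0<½* (0<½* 0<ε)))
  where
  go : ∀ ε → 0ℚ ℚ.< ε →
       (∃[ N ] ∀ m n → N ℕ.≤ m → N ℕ.≤ n → ℚ.∣ seq x m ℚ.- seq x n ∣ ℚ.< ½ ℚ.* (½ ℚ.* ε)) →
       Eventually λ n → ℚ.∣ seq x n ℚ.- 0ℚ ∣ ℚ.< ε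
  go ε 0<ε (N , f) with ℚ.∣ seq x N ∣ ℚ.≤? ½ ℚ.* ε
  ... | yes xN≤ = N , λ n N≤n → ≡.subst (λ t → ℚ.∣ t ∣ ℚ.< ε) (≡.sym (ℚ.+-identityʳ (seq x n)))
        (ℚ.<-≤-trans (near n N N≤n ℕ.≤-refl) (by-gap _ (ℚ.+-mono-≤ (0≤q-p xN≤) (ℚ.<⇒≤ (0<½* (0<½* 0<ε))))
          (solve 2 (λ x e → let q = con ½ :* (con ½ :* e) in
              (x :+ q) :+ ((con ½ :* e :- x) :+ q) := e) ≡.refl (ℚ.∣ seq x N ∣) ε)))
    where
    near : ∀ m n → N ℕ.≤ m → N ℕ.≤ n → ℚ.∣ seq x m ∣ ℚ.< ℚ.∣ seq x n ∣ ℚ.+ ½ ℚ.* (½ ℚ.* ε)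
    near m n p q = -⇒+ ℚ.∣ seq x n ∣ (ℚ.≤-<-trans (∣∣-triangle (seq x m) (seq x n)) (f m n p q))
  ... | no xN≰ = contradiction (apart⇒invertible x (½ ℚ.* (½ ℚ.* ε)) (0<½* (0<½* 0<ε))
      (N , λ n N≤n → by-gap _ (ℚ.+-mono-≤ (0≤q-p (ℚ.<⇒≤ (ℚ.≰⇒> xN≰))) (0≤q-p (ℚ.<⇒≤ (near N n ℕ.≤-refl N≤n))))
        (solve 3 (λ x y e → let q = con ½ :* (con ½ :* e) in
          q :+ ((x :- con ½ :* e) :+ ((y :+ q) :- x)) := y)
          ≡.refl (ℚ.∣ seq x N ∣) (ℚ.∣ seq x n ∣) ε))) none
    where
    near : ∀ m n → N ℕ.≤ m → N ℕ.≤ n → ℚ.∣ seq x m ∣ ℚ.< ℚ.∣ seq x n ∣ ℚ.+ ½ ℚ.* (½ ℚ.* ε)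
    near m n p q = -⇒+ ℚ.∣ seq x n ∣ (ℚ.≤-<-trans (∣∣-triangle (seq x m) (seq x n)) (f m n p q))

1≉0 : ¬ 1ℝ ≈ 0ℝ
1≉0 eq = let N , p = eq 1ℚ (ℚ.positive⁻¹ 1ℚ) in ℚ.<-irrefl ≡.refl (p N ℕ.≤-refl)

ℝ-euclideanField : EuclideanField
ℝ-euclideanField = record
  { commutativeRing = ℝ-commutativeRing
  ; _≤_ = _≤_
  ; isPartialOrder = record
    { isPreorder = record
      { isEquivalence = CommutativeRing.isEquivalence ℝ-commutativeRing
      ; reflexive = λ {x} {y} → ≈⇒≤ x y
      ; trans = λ {x} {y} {z} → ≤-trans x y z }
    ; antisym = λ {x} {y} → ≤-antisym x y }
  ; ≤-stable = λ {x} {y} → ≤-stable x y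
  ; +-mono-≤ = λ {w} {x} {y} {z} → +-mono-≤ w x y z
  ; *-nonneg = λ {x} {y} → *-nonneg x y
  ; square-nonneg = λ x → pointwise-≤ 0ℝ (x * x) (square-nonnegℚ ∘ seq x)
  ; sqrt = λ {x} 0≤x → (√ x) , 0≤√ x , √-square x 0≤x
  ; 1≉0 = 1≉0
  ; invert = λ {x} → invert x
  ; ℚ-morphism = record
    { ⟦_⟧ = fromℚ
    ; +-homo = λ p q → pointwise-≈ (fromℚ (p +ℚ q)) (fromℚ p + fromℚ q) λ _ → ≡.refl
    ; *-homo = λ p q → pointwise-≈ (fromℚ (p ℚ.* q)) (fromℚ p * fromℚ q) λ _ → ≡.refl
    ; -‿homo = λ p → pointwise-≈ (fromℚ (ℚ.- p)) (- fromℚ p) λ _ → ≡.refl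
    ; 0-homo = pointwise-≈ 0ℝ 0ℝ λ _ → ≡.refl
    ; 1-homo = pointwise-≈ 1ℝ 1ℝ λ _ → ≡.refl } }

-- Spectra of a graph and its complement

module LA = LinearAlgebra ℝ-euclideanField

≈-refl : ∀ x → x ≈ x
≈-refl x = pointwise-≈ x x λ _ → ≡.refl

≈-reflexive : ∀ x y → x ≡ y → x ≈ y
≈-reflexive x y ≡.refl = ≈-refl x

-- Natural numbers as reals

suc/1 : ∀ n → + suc n / 1 ≡ 1ℚ +ℚ (+ n / 1)
suc/1 n = ≡.trans (≡.sym (ℚ.*-identityʳ (+ suc n / 1))) (≡.trans (suc⊙ n 1ℚ)
  (≡.trans (≡.cong (_+ℚ 1ℚ) (ℚ.*-identityʳ (+ n / 1))) (ℚ.+-comm (+ n / 1) 1ℚ)))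

count≈ : ∀ n → LA.count n ≈ fromℚ (+ n / 1)
count≈ zero    = LA.count-0
count≈ (suc n) = ≈-trans (LA.count (suc n)) (1ℝ + LA.count n) (fromℚ (+ suc n / 1)) (LA.count-suc n)
  (≈-trans (1ℝ + LA.count n) (1ℝ + fromℚ (+ n / 1)) (fromℚ (+ suc n / 1))
    (+-cong 1ℝ 1ℝ (LA.count n) (fromℚ (+ n / 1)) (≈-refl 1ℝ) (count≈ n))
    (pointwise-≈ (1ℝ + fromℚ (+ n / 1)) (fromℚ (+ suc n / 1)) λ _ → ≡.sym (suc/1 n)))

mesh-* : ∀ k → mesh k ℚ.* (+ suc k / 1) ≡ 1ℚ
mesh-* k = ≡.trans (ℚ.*-comm (mesh k) (+ suc k / 1))
  (≡.trans (≡.cong (_⊙ mesh k) (≡.sym (ℕ.*-identityʳ (suc k)))) (⊙-mesh k 1))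

recip-count : ∀ k → recip (suc k) * LA.count (suc k) ≈ 1ℝ
recip-count k = ≈-trans (r * LA.count (suc k)) (r * fromℚ (+ suc k / 1)) 1ℝ
  (*-cong r r (LA.count (suc k)) (fromℚ (+ suc k / 1)) (≈-refl r) (count≈ (suc k)))
  (pointwise-≈ (r * fromℚ (+ suc k / 1)) 1ℝ λ _ → mesh-* k)
  where
  r = recip (suc k)

-- Fractions are stored in lowest terms, so this is not a computation; instead one factor K is
-- rewritten as `K² * mesh k`, and the mesh cancels the other factor.
square/1 : ∀ k → + (suc k ℕ.* suc k) / 1 ≡ (+ suc k / 1) ℚ.* (+ suc k / 1)
square/1 k = ≡.sym (≡.trans (≡.cong (ℚ._* K) (≡.sym (⊙-mesh k (suc k))))
  (≡.trans (ℚ.*-assoc K² (mesh k) K) (≡.trans (≡.cong (K² ℚ.*_) (mesh-* k)) (ℚ.*-identityʳ K²))))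
  where
  K = + suc k / 1
  K² = + (suc k ℕ.* suc k) / 1

count-square : ∀ k → LA.count (suc k ℕ.* suc k) ≈ LA.count (suc k) * LA.count (suc k)
count-square k = ≈-trans (LA.count (suc k ℕ.* suc k)) (fromℚ (+ (suc k ℕ.* suc k) / 1)) (c * c)
  (count≈ (suc k ℕ.* suc k))
  (≈-trans (fromℚ (+ (suc k ℕ.* suc k) / 1)) (K * K) (c * c)
    (pointwise-≈ (fromℚ (+ (suc k ℕ.* suc k) / 1)) (K * K) λ _ → square/1 k)
    (*-cong K c K c (≈-sym c K (count≈ (suc k))) (≈-sym c K (count≈ (suc k)))))
  where
  c = LA.count (suc k)
  K = fromℚ (+ suc k / 1)

0≤recip : ∀ k → 0ℝ ≤ recip (suc k)
0≤recip k = pointwise-≤ 0ℝ (recip (suc k)) λ _ → ℚ.<⇒≤ (mesh>0 k)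

count-*≉0 : ∀ n x → ¬ x ≈ 0ℝ → ¬ LA.count (suc n) * x ≈ 0ℝ
count-*≉0 n x x≉0 cx≈0 = x≉0
  (≈-trans x (1ℝ * x) 0ℝ (pointwise-≈ x (1ℝ * x) (≡.sym ∘ ℚ.*-identityˡ ∘ seq x))
  (≈-trans (1ℝ * x) (r * c * x) 0ℝ
    (*-cong 1ℝ (r * c) x x (≈-sym (r * c) 1ℝ (recip-count n)) (≈-refl x))
  (≈-trans (r * c * x) (r * (c * x)) 0ℝ
    (pointwise-≈ (r * c * x) (r * (c * x)) λ k → ℚ.*-assoc (seq r k) (seq c k) (seq x k))
  (≈-trans (r * (c * x)) (r * 0ℝ) 0ℝ (*-cong r r (c * x) 0ℝ (≈-refl r) cx≈0)
    (pointwise-≈ (r * 0ℝ) 0ℝ (ℚ.*-zeroʳ ∘ seq r))))))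
  where
  r = recip (suc n)
  c = LA.count (suc n)

count≉0 : ∀ n → ¬ LA.count (suc n) ≈ 0ℝ
count≉0 n c≈0 = count-*≉0 n 1ℝ 1≉0 (≈-trans (c * 1ℝ) c 0ℝ
  (pointwise-≈ (c * 1ℝ) c (ℚ.*-identityʳ ∘ seq c)) c≈0)
  where
  c = LA.count (suc n)

-- Adjacency matrices of a graph and its complement

adjacency-symmetric : ∀ {n} (G : Graph n) → LA.Symmetric (adjacencyMatrix G)
adjacency-symmetric G r c = ≈-reflexive (adjacencyMatrix G r c) (adjacencyMatrix G c r)
  (≡.cong (if_then 1ℝ else 0ℝ) (symmetric G r c))

-- Every pair is exactly one of an edge, an edge of the complement, or diagonal; looplessness
-- excludes edges on the diagonal.
complement-partition : ∀ {n} (G : Graph n) r c →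
  adjacencyMatrix G r c + adjacencyMatrix (complement G) r c + LA.δ r c ≈ 1ℝ
complement-partition G r c = cases (adj G r c) (does (r Fin.≟ c)) exclusive
  where
  exclusive : adj G r c ≡ true → does (r Fin.≟ c) ≡ false
  exclusive r~c = dec-false (r Fin.≟ c) λ where
    ≡.refl → contradiction (≡.trans (≡.sym r~c) (loopless G r)) λ ()
  cases : ∀ a d → (a ≡ true → d ≡ false) →
    (if a then 1ℝ else 0ℝ) + (if not a ∧ not d then 1ℝ else 0ℝ) + (if d then 1ℝ else 0ℝ) ≈ 1ℝ
  cases true  false _   = pointwise-≈ (1ℝ + 0ℝ + 0ℝ) 1ℝ λ _ → ≡.refl
  cases true  true  exc = contradiction (exc ≡.refl) λ ()
  cases false false _   = pointwise-≈ (0ℝ + 1ℝ + 0ℝ) 1ℝ λ _ → ≡.refl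
  cases false true  _   = pointwise-≈ (0ℝ + 0ℝ + 1ℝ) 1ℝ λ _ → ≡.refl

0≤1ℚ : 0ℚ ℚ.≤ 1ℚ
0≤1ℚ = ℚ.nonNegative⁻¹ 1ℚ

adjacency-square≤1 : ∀ {n} (G : Graph n) r c → adjacencyMatrix G r c * adjacencyMatrix G r c ≤ 1ℝ
adjacency-square≤1 G r c with adj G r c
... | true  = pointwise-≤ (1ℝ * 1ℝ) 1ℝ λ _ → ℚ.≤-refl
... | false = pointwise-≤ (0ℝ * 0ℝ) 1ℝ λ _ → 0≤1ℚ

complement-square≤1 : ∀ {n} (G : Graph n) r c →
  let s = adjacencyMatrix G r c - adjacencyMatrix (complement G) r c in s * s ≤ 1ℝ
complement-square≤1 G r c = cases (adj G r c) (not (does (r Fin.≟ c)))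
  where
  cases : ∀ a e → let s = (if a then 1ℝ else 0ℝ) - (if not a ∧ e then 1ℝ else 0ℝ) in s * s ≤ 1ℝ
  cases true  e     = pointwise-≤ ((1ℝ - 0ℝ) * (1ℝ - 0ℝ)) 1ℝ λ _ → ℚ.≤-refl
  cases false true  = pointwise-≤ ((0ℝ - 1ℝ) * (0ℝ - 1ℝ)) 1ℝ λ _ → ℚ.≤-refl
  cases false false = pointwise-≤ ((0ℝ - 0ℝ) * (0ℝ - 0ℝ)) 1ℝ λ _ → 0≤1ℚ

-- Carries hypotheses stated with `sum` over to the sealed `LA.∑`.
∑≡sum : ∀ {n} (f : Vector ℝ n) → LA.∑ f ≡ sum f
∑≡sum f = LA.∑≡sum f

independent : ∀ {m n} (v : Vector (Vector ℝ n) m) → LinearlyIndependent v → LA.LinearlyIndependent v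
independent v indep c eq =
  indep c λ r → ≡.subst (λ x → x ≈ 0ℝ) (∑≡sum λ k → c k * v k r) (eq r)

eigenfamily : ∀ {m n} (A : Matrix n) μ (v : Vector (Vector ℝ n) m) →
  (∀ k → A · v k ≈ᵥ λ r → μ k * v k r) → LA.Eigenfamily A μ v
eigenfamily A μ v eig k r =
  ≡.subst (λ x → x ≈ μ k * v k r) (≡.sym (∑≡sum λ c → A r c * v k c)) (eig k r)

-- Positions in the spectrum

toℕ-fromBottom : ∀ {n} i .{{_ : NonZero i}} (i≤n : i ℕ.≤ n) → toℕ (fromBottom i i≤n) ≡ n ℕ.∸ i
toℕ-fromBottom i i≤n = Fin.toℕ-fromℕ< _

-- The positions `n - i + k` of the `i` smallest eigenvalues. The case `k = 0` is the position of
-- `fromBottom`, which holds the largest of them.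
bottomIndex : ∀ {n} i → i ℕ.≤ n → Fin i → Fin n
bottomIndex {n} i i≤n k = Fin.cast (ℕ.m∸n+n≡m i≤n) ((n ℕ.∸ i) ↑ʳ k)

toℕ-bottomIndex : ∀ {n} i (i≤n : i ℕ.≤ n) k → toℕ (bottomIndex i i≤n k) ≡ n ℕ.∸ i ℕ.+ toℕ k
toℕ-bottomIndex {n} i i≤n k = ≡.trans (Fin.toℕ-cast _ _) (Fin.toℕ-↑ʳ (n ℕ.∸ i) k)

bottomIndex-injective : ∀ {n} i (i≤n : i ℕ.≤ n) → Injective _≡_ _≡_ (bottomIndex i i≤n)
bottomIndex-injective {n} i i≤n {k} {l} eq = Fin.toℕ-injective (ℕ.+-cancelˡ-≡ (n ℕ.∸ i) (toℕ k) (toℕ l)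
  (≡.trans (≡.sym (toℕ-bottomIndex i i≤n k)) (≡.trans (≡.cong toℕ eq) (toℕ-bottomIndex i i≤n l))))

fromBottom≤bottomIndex : ∀ {n} i .{{_ : NonZero i}} (i≤n : i ℕ.≤ n) k →
                         fromBottom i i≤n Fin.≤ bottomIndex i i≤n k
fromBottom≤bottomIndex {n} i i≤n k =
  ≡.subst₂ ℕ._≤_ (≡.sym (toℕ-fromBottom i i≤n)) (≡.sym (toℕ-bottomIndex i i≤n k))
    (ℕ.m≤m+n (n ℕ.∸ i) (toℕ k))

inject≤-≤fromBottom : ∀ {n m} i .{{_ : NonZero i}} (i≤n : i ℕ.≤ n) →
  m ℕ.+ i ℕ.≤ n → (m≤n : m ℕ.≤ n) (k : Fin m) → inject≤ k m≤n Fin.≤ fromBottom i i≤n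
inject≤-≤fromBottom {n} {m} i i≤n m+i≤n m≤n k =
  ≡.subst₂ ℕ._≤_ (≡.sym (Fin.toℕ-inject≤ k m≤n)) (≡.sym (toℕ-fromBottom i i≤n))
    (ℕ.≤-trans (ℕ.<⇒≤ (Fin.toℕ<n k)) (ℕ.m+n≤o⇒m≤o∸n m m+i≤n))

-- Square roots of positive rationals

√-fromℚ-square : ∀ q → 0ℚ ℚ.< q → (√ fromℚ q) * (√ fromℚ q) ≈ fromℚ q
√-fromℚ-square q 0<q = √-square (fromℚ q) (pointwise-≤ 0ℝ (fromℚ q) λ _ → ℚ.<⇒≤ 0<q)

√-+-square : ∀ p q → 0ℚ ℚ.< p +ℚ q →
             (√ fromℚ (p +ℚ q)) * (√ fromℚ (p +ℚ q)) ≈ fromℚ p + fromℚ q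
√-+-square p q 0<p+q =
  ≈-trans ((√ fromℚ (p +ℚ q)) * (√ fromℚ (p +ℚ q))) (fromℚ (p +ℚ q)) (fromℚ p + fromℚ q)
  (√-fromℚ-square (p +ℚ q) 0<p+q)
  (pointwise-≈ (fromℚ (p +ℚ q)) (fromℚ p + fromℚ q) λ _ → ≡.refl)

fromℚ≉0 : ∀ q → 0ℚ ℚ.< q → ¬ fromℚ q ≈ 0ℝ
fromℚ≉0 q 0<q q≈0 = let N , near = q≈0 q 0<q in ℚ.<-irrefl ≡.refl
  (ℚ.≤-<-trans (p≤∣p∣ q) (≡.subst (λ t → ℚ.∣ t ∣ ℚ.< q) (ℚ.+-identityʳ q) (near N ℕ.≤-refl)))

√≉0 : ∀ q → 0ℚ ℚ.< q → ¬ (√ fromℚ q) ≈ 0ℝ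
√≉0 q 0<q s≈0 = fromℚ≉0 q 0<q
  (≈-trans (fromℚ q) (s * s) 0ℝ (≈-sym (s * s) (fromℚ q) (√-fromℚ-square q 0<q))
    (≈-trans (s * s) (0ℝ * 0ℝ) 0ℝ (*-cong s 0ℝ s 0ℝ s≈0 s≈0) (pointwise-≈ (0ℝ * 0ℝ) 0ℝ λ _ → ≡.refl)))
  where
  s = √ fromℚ q

-- Bounds for a single graph

neg-scale-≤ : ∀ r x y u → x ≈ y → - (r * y) ≤ u → - (r * x) ≤ u
neg-scale-≤ r x y u x≈y = ≤-trans (- (r * x)) (- (r * y)) u
  (≈⇒≤ (- (r * x)) (- (r * y)) (-‿cong (r * x) (r * y) (*-cong r r x y (≈-refl r) x≈y)))

scale-≤ : ∀ r x y u → x ≈ y → r * y ≤ u → r * x ≤ u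
scale-≤ r x y u x≈y = ≤-trans (r * x) (r * y) u
  (≈⇒≤ (r * x) (r * y) (*-cong r r x y (≈-refl r) x≈y))

-- Because `mesh i` is `1 / (i + 1)`, the reciprocals belonging to `suc i` and `suc j` are `mesh i`
-- and `mesh j`. The root `s` enters only through its sign, its square and being nonzero.
eigenvalue-sum-lower : ∀ i j n (i≤n : suc i ℕ.≤ suc n) (j≤n : suc j ℕ.≤ suc n) (G : Graph (suc n)) x s →
  0ℝ ≤ s → s * s ≈ fromℚ (mesh i) + fromℚ (mesh j) → ¬ s ≈ 0ℝ →
  IsEigenvalueSum (suc i) (suc j) i≤n j≤n G x →
  - (recip (suc n) * x) ≤ fromℚ ½ * s + recip (suc n)
eigenvalue-sum-lower i j n i≤n j≤n G x s 0≤s s² s≉0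
  (ev , ev′ , (ev↓ , v , (v-indep , _) , v-eig) , (ev′↓ , w , (w-indep , _) , w-eig) , x≈) =
  neg-scale-≤ (recip (suc n)) x (ev (fromBottom (suc i) i≤n) + ev′ (fromBottom (suc j) j≤n))
    (fromℚ ½ * s + recip (suc n)) x≈
    (LA.normalised-lower {LA.count (suc n)} {recip (suc n)} {s}
      {ev (fromBottom (suc i) i≤n)} {ev′ (fromBottom (suc j) j≤n)} (0≤recip n) (recip-count n)
      (LA.smallest-eigenvalues {A = adjacencyMatrix G} {adjacencyMatrix (complement G)} {ev} {ev′}
        {v} {w} {ev (fromBottom (suc i) i≤n)} {ev′ (fromBottom (suc j) j≤n)} {fromℚ (mesh i)} {fromℚ (mesh j)} {s}
        (bottomIndex (suc i) i≤n) (bottomIndex (suc j) j≤n)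
        (bottomIndex-injective (suc i) i≤n) (bottomIndex-injective (suc j) j≤n)
        (adjacency-symmetric G) (adjacency-symmetric (complement G))
        (complement-partition G) (complement-square≤1 G)
        (independent v v-indep) (eigenfamily (adjacencyMatrix G) ev v v-eig)
        (λ k → ev↓ (fromBottom (suc i) i≤n) (bottomIndex (suc i) i≤n k)
                 (fromBottom≤bottomIndex (suc i) i≤n k))
        (independent w w-indep) (eigenfamily (adjacencyMatrix (complement G)) ev′ w w-eig)
        (λ k → ev′↓ (fromBottom (suc j) j≤n) (bottomIndex (suc j) j≤n k)
                  (fromBottom≤bottomIndex (suc j) j≤n k))
        (0≤recip i) (recip-count i) (0≤recip j) (recip-count j) 0≤s s² (count-*≉0 n s s≉0)))

-- The size condition places the first `(k + 1)²` positions before that of `fromBottom`, so all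
-- eigenvalues there are at least the one to be bounded.
fromBottom-upper : ∀ k i .{{_ : NonZero i}} n (i≤n : i ℕ.≤ suc n) → suc k ℕ.* suc k ℕ.+ i ℕ.≤ suc n →
  (G : Graph (suc n)) (ev : Vector ℝ (suc n)) → IsSpectrum (adjacencyMatrix G) ev →
  0ℝ ≤ LA.count (suc n) + LA.count (suc k) * (- ev (fromBottom i i≤n))
fromBottom-upper k i n i≤n i-small G ev (ev↓ , v , (v-indep , _) , v-eig) =
  LA.largest-eigenvalues {A = adjacencyMatrix G} {ev} {v} {ev (fromBottom i i≤n)} {LA.count (suc k)}
    (λ l → inject≤ l K²≤n) (λ {l} {m} eq → Fin.inject≤-injective K²≤n K²≤n l m eq)
    (adjacency-symmetric G) (adjacency-square≤1 G)
    (independent v v-indep) (eigenfamily (adjacencyMatrix G) ev v v-eig)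
    (λ l → ev↓ (inject≤ l K²≤n) (fromBottom i i≤n) (inject≤-≤fromBottom i i≤n i-small K²≤n l))
    (LA.0≤count (suc k)) (count-square k) (count-*≉0 n (LA.count (suc k)) (count≉0 k))
  where
  K²≤n : suc k ℕ.* suc k ℕ.≤ suc n
  K²≤n = ℕ.m+n≤o⇒m≤o (suc k ℕ.* suc k) i-small

eigenvalue-sum-upper : ∀ k i j n (i≤n : suc i ℕ.≤ suc n) (j≤n : suc j ℕ.≤ suc n) →
  suc k ℕ.* suc k ℕ.+ suc i ℕ.≤ suc n → suc k ℕ.* suc k ℕ.+ suc j ℕ.≤ suc n → (G : Graph (suc n)) → ∀ x →
  IsEigenvalueSum (suc i) (suc j) i≤n j≤n G x → recip (suc n) * x ≤ fromℚ (mesh k) + fromℚ (mesh k)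
eigenvalue-sum-upper k i j n i≤n j≤n i-small j-small G x (ev , ev′ , spec , spec′ , x≈) =
  scale-≤ (recip (suc n)) x (ev (fromBottom (suc i) i≤n) + ev′ (fromBottom (suc j) j≤n))
    (fromℚ (mesh k) + fromℚ (mesh k)) x≈
    (LA.normalised-upper {LA.count (suc n)} {recip (suc n)} {LA.count (suc k)} {fromℚ (mesh k)}
      {ev (fromBottom (suc i) i≤n)} {ev′ (fromBottom (suc j) j≤n)}
      (0≤recip n) (recip-count n) (0≤recip k) (recip-count k)
      (fromBottom-upper k (suc i) n i≤n i-small G ev spec)
      (fromBottom-upper k (suc j) n j≤n j-small (complement G) ev′ spec′))

-- Passage to the limit

≤-archimedean : ∀ x y → (∀ ε → 0ℚ ℚ.< ε → x ≤ y + fromℚ ε) → x ≤ y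
≤-archimedean x y x≤y+ ε 0<ε = let N , p = x≤y+ _ (0<½* 0<ε) _ (0<½* 0<ε) in
  N , λ n N≤n → halve-≤ (seq y n) ε (p n N≤n)

⟶-close : ∀ {f ℓ} → f ⟶ ℓ → ∀ ε → 0ℚ ℚ.< ε → Eventually λ n → ∣ f n - ℓ ∣ ≤ fromℚ ε
⟶-close {f} {ℓ} f⟶ℓ ε 0<ε =
  let N , p = f⟶ℓ (fromℚ ε) (ε , 0<ε , 0 , λ _ _ → ℚ.≤-reflexive (ℚ.+-identityˡ ε)) in
  N , λ n N≤n ε′ 0<ε′ → let δ , 0<δ , M , q = p n N≤n in M , λ k M≤k →
    ℚ.≤-trans (p≤p+ε (seq (∣ f n - ℓ ∣) k) 0<δ) (ℚ.≤-trans (q k M≤k) (p≤p+ε ε 0<ε′))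

limit-≤ : ∀ x y e → ∣ x - y ∣ ≤ e → y ≤ x + e
limit-≤ x y e near = ≤-trans y (x + ∣ x - y ∣) (x + e)
  (pointwise-≤ y (x + ∣ x - y ∣) λ n → ≡.subst (ℚ._≤ seq x n +ℚ ℚ.∣ seq x n ℚ.- seq y n ∣)
    (solve 2 (λ x y → x :+ :- (x :- y) := y) ≡.refl (seq x n) (seq y n))
    (ℚ.+-monoʳ-≤ (seq x n) (≡.subst (ℚ.- (seq x n ℚ.- seq y n) ℚ.≤_) (ℚ.∣-p∣≡∣p∣ (seq x n ℚ.- seq y n))
      (p≤∣p∣ (ℚ.- (seq x n ℚ.- seq y n))))))
  (+-mono-≤ x x (∣ x - y ∣) e (≈⇒≤ x x (≈-refl x)) near)

limit-neg-≤ : ∀ x y e → ∣ x - y ∣ ≤ e → - y ≤ - x + e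
limit-neg-≤ x y e near = ≤-trans (- y) (- x + ∣ x - y ∣) (- x + e)
  (pointwise-≤ (- y) (- x + ∣ x - y ∣) λ n → ≡.subst (ℚ._≤ ℚ.- seq x n +ℚ ℚ.∣ seq x n ℚ.- seq y n ∣)
    (solve 2 (λ x y → :- x :+ (x :- y) := :- y) ≡.refl (seq x n) (seq y n))
    (ℚ.+-monoʳ-≤ (ℚ.- seq x n) (p≤∣p∣ (seq x n ℚ.- seq y n))))
  (+-mono-≤ (- x) (- x) (∣ x - y ∣) e (≈⇒≤ (- x) (- x) (≈-refl (- x))) near)

∣∣-≤ : ∀ x y → x ≤ y → - x ≤ y → ∣ x ∣ ≤ y
∣∣-≤ x y x≤y -x≤y ε 0<ε = eventually-zip
  (λ n p q → abs (ℚ.∣p∣≡p∨∣p∣≡-p (seq x n)) p q)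
  (x≤y ε 0<ε) (-x≤y ε 0<ε)
  where
  abs : ∀ {p q} → ℚ.∣ p ∣ ≡ p ⊎ ℚ.∣ p ∣ ≡ ℚ.- p → p ℚ.≤ q → ℚ.- p ℚ.≤ q → ℚ.∣ p ∣ ℚ.≤ q
  abs {q = q} (inj₁ eq) p≤q _ = ≡.subst (ℚ._≤ q) (≡.sym eq) p≤q
  abs {q = q} (inj₂ eq) _ -p≤q = ≡.subst (ℚ._≤ q) (≡.sym eq) -p≤q

limit-upper : ∀ f β e u t → ∣ f - β ∣ ≤ e → f ≤ u → u + e ≤ t → β ≤ t
limit-upper f β e u t near f≤u u+e≤t = ≤-trans β (f + e) t (limit-≤ f β e near)
  (≤-trans (f + e) (u + e) t (+-mono-≤ f u e e f≤u (≈⇒≤ e e (≈-refl e))) u+e≤t)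

limit-lower : ∀ f β e u t → ∣ f - β ∣ ≤ e → - f ≤ u → u + e ≤ t → - β ≤ t
limit-lower f β e u t near -f≤u u+e≤t = ≤-trans (- β) (- f + e) t (limit-neg-≤ f β e near)
  (≤-trans (- f + e) (u + e) t (+-mono-≤ (- f) u e e -f≤u (≈⇒≤ e e (≈-refl e))) u+e≤t)

-- The error budget for the upper bound: `ε / 4` for the estimate of each eigenvalue and `ε / 2` for
-- the distance to the limit.
quarters : ∀ h ε → h ℚ.≤ ½ ℚ.* (½ ℚ.* ε) → fromℚ h + fromℚ h + fromℚ (½ ℚ.* ε) ≤ 0ℝ + fromℚ ε
quarters h ε h≤ = pointwise-≤ (fromℚ h + fromℚ h + fromℚ (½ ℚ.* ε)) (0ℝ + fromℚ ε) λ _ → by-gap _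
  (ℚ.+-mono-≤ (0≤q-p h≤) (0≤q-p h≤))
  (solve 2 (λ h e → let ¼e = con ½ :* (con ½ :* e) in
       h :+ h :+ con ½ :* e :+ (¼e :- h :+ (¼e :- h)) := con 0ℚ :+ e)
     ≡.refl h ε)

halves : ∀ u n ε → mesh n ℚ.≤ ½ ℚ.* ε → u + recip (suc n) + fromℚ (½ ℚ.* ε) ≤ u + fromℚ ε
halves u n ε h≤ = pointwise-≤ (u + recip (suc n) + fromℚ (½ ℚ.* ε)) (u + fromℚ ε) λ t → by-gap _
  (0≤q-p h≤)
  (solve 3 (λ u h e → let ½e = con ½ :* e in
       u :+ h :+ ½e :+ (½e :- h) := u :+ e)
     ≡.refl (seq u t) (mesh n) ε)

-- For each `ε` a single large size is enough: the minimum is attained by some graph, and the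
-- estimate holds for every graph. The number `k` is fixed from `ε` before the size.
β≤0 : ∀ i j β → Isβ (suc i) (suc j) β → β ≤ 0ℝ
β≤0 i j β (m , minimum , m⟶β) = ≤-archimedean β 0ℝ λ ε 0<ε →
  step ε (mesh-small (½ ℚ.* (½ ℚ.* ε)) (0<½* (0<½* 0<ε)))
         (⟶-close {λ n → recip n * m n} {β} m⟶β (½ ℚ.* ε) (0<½* 0<ε))
  where
  step : ∀ ε → (∃[ k ] ∀ l → k ℕ.≤ l → mesh l ℚ.< ½ ℚ.* (½ ℚ.* ε)) →
         (Eventually λ n → ∣ recip n * m n - β ∣ ≤ fromℚ (½ ℚ.* ε)) → β ≤ 0ℝ + fromℚ ε
  step ε (k , small) (N , near) =
    limit-upper (recip (suc n) * m (suc n)) β (fromℚ (½ ℚ.* ε))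
      (fromℚ (mesh k) + fromℚ (mesh k)) (0ℝ + fromℚ ε)
      (near (suc n) (ℕ.m≤n⇒m≤1+n (ℕ.m≤m+n N _)))
      (let (G , isSum) , _ = minimum (suc n) i≤n j≤n in
       eigenvalue-sum-upper k i j n i≤n j≤n K²+i≤n K²+j≤n G (m (suc n)) isSum)
      (quarters (mesh k) ε (ℚ.<⇒≤ (small k ℕ.≤-refl)))
    where
    K² = suc k ℕ.* suc k
    -- Large enough at once for the convergence modulus and for both size conditions.
    n = N ℕ.+ (K² ℕ.+ (suc i ℕ.+ suc j))
    K²+i+j≤n : K² ℕ.+ (suc i ℕ.+ suc j) ℕ.≤ suc n
    K²+i+j≤n = ℕ.m≤n⇒m≤1+n (ℕ.m≤n+m _ N)
    K²+i≤n = ℕ.≤-trans (ℕ.+-monoʳ-≤ K² (ℕ.m≤m+n (suc i) (suc j))) K²+i+j≤n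
    K²+j≤n = ℕ.≤-trans (ℕ.+-monoʳ-≤ K² (ℕ.m≤n+m (suc j) (suc i))) K²+i+j≤n
    i≤n = ℕ.m+n≤o⇒n≤o K² K²+i≤n
    j≤n = ℕ.m+n≤o⇒n≤o K² K²+j≤n

-β≤ : ∀ i j β s → 0ℝ ≤ s → s * s ≈ fromℚ (mesh i) + fromℚ (mesh j) → ¬ s ≈ 0ℝ →
      Isβ (suc i) (suc j) β → - β ≤ fromℚ ½ * s
-β≤ i j β s 0≤s s² s≉0 (m , minimum , m⟶β) = ≤-archimedean (- β) (fromℚ ½ * s) λ ε 0<ε →
  step ε (mesh-small (½ ℚ.* ε) (0<½* 0<ε))
         (⟶-close {λ n → recip n * m n} {β} m⟶β (½ ℚ.* ε) (0<½* 0<ε))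
  where
  step : ∀ ε → (∃[ M ] ∀ l → M ℕ.≤ l → mesh l ℚ.< ½ ℚ.* ε) →
         (Eventually λ n → ∣ recip n * m n - β ∣ ≤ fromℚ (½ ℚ.* ε)) → - β ≤ fromℚ ½ * s + fromℚ ε
  step ε (M , small) (N , near) =
    limit-lower (recip (suc n) * m (suc n)) β (fromℚ (½ ℚ.* ε))
      (fromℚ ½ * s + recip (suc n)) (fromℚ ½ * s + fromℚ ε)
      (near (suc n) (ℕ.m≤n⇒m≤1+n (ℕ.m≤m+n N _)))
      (let (G , isSum) , _ = minimum (suc n) i≤n j≤n in
       eigenvalue-sum-lower i j n i≤n j≤n G (m (suc n)) s 0≤s s² s≉0 isSum)
      (halves (fromℚ ½ * s) n ε (ℚ.<⇒≤ (small n (ℕ.≤-trans (ℕ.m≤m+n M _) (ℕ.m≤n+m _ N)))))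
    where
    -- The summand `M` makes the error `1 / (n + 1)` smaller than `ε / 2`.
    n = N ℕ.+ (M ℕ.+ (suc i ℕ.+ suc j))
    i+j≤n : suc i ℕ.+ suc j ℕ.≤ suc n
    i+j≤n = ℕ.m≤n⇒m≤1+n (ℕ.≤-trans (ℕ.m≤n+m _ M) (ℕ.m≤n+m _ N))
    i≤n = ℕ.m+n≤o⇒m≤o (suc i) i+j≤n
    j≤n = ℕ.m+n≤o⇒n≤o (suc i) i+j≤n

-- The reciprocals enter through equations, so that `+ 1 / suc i` and `mesh i` are identified as
-- rationals, outside the square root.
∣β∣≤ : ∀ i j β p q → p ≡ mesh i → q ≡ mesh j → Isβ (suc i) (suc j) β →
       ∣ β ∣ ≤ fromℚ ½ * (√ fromℚ (p +ℚ q))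
∣β∣≤ i j β p q ≡.refl ≡.refl isβ = ∣∣-≤ β (fromℚ ½ * (√ fromℚ (p +ℚ q)))
  (≤-trans β 0ℝ (fromℚ ½ * (√ fromℚ (p +ℚ q))) (β≤0 i j β isβ)
    (*-nonneg (fromℚ ½) (√ fromℚ (p +ℚ q))
      (pointwise-≤ 0ℝ (fromℚ ½) λ _ → ℚ.nonNegative⁻¹ ½) (0≤√ (fromℚ (p +ℚ q)))))
  (-β≤ i j β (√ fromℚ (p +ℚ q)) (0≤√ (fromℚ (p +ℚ q)))
    (√-+-square p q 0<p+q) (√≉0 (p +ℚ q) 0<p+q) isβ)
  where
  0<p+q = ℚ.+-mono-< (mesh>0 i) (mesh>0 j)

theorem5 : ∀ (i j : ℕ) .{{_ : NonZero i}} .{{_ : NonZero j}} (β : ℝ) →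
    Isβ i j β →
    ∣ β ∣ ≤ fromℚ ½ * (√ fromℚ ((+ 1 / i) +ℚ (+ 1 / j)))
theorem5 (suc i) (suc j) β = ∣β∣≤ i j β (+ 1 / suc i) (+ 1 / suc j) ≡.refl ≡.refl
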